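{- Let $k$ be a positive integer. The vertex set of every $n$-vertex tournament $T$ can be partitioned into at most $2^{10^5k}$ sets, each of which spans (contains) the $k$-th power of a directed path; i.e. $T$ can be partitioned into at most $2^{10^5k}$ vertex-disjoint $k$-th powers of directed paths.
   Context: A tournament is a complete graph in which every edge is given an orientation; we write $x\to y$ if the edge between $x$ and $y$ is oriented from $x$ to $y$. The $k$-th power of a directed path is a sequence of distinct vertices $x_1,\dots,x_n$ such that $x_i\to x_j$ for every $1\le i<j\le i+k\le n$ (a single vertex counts as such a path). -}

module Defs where

open import Data.Nat using (ℕ; _+_; _<_; _≤_)
open import Data.Fin using (Fin; toℕ)
open import Data.List using (List; []; length; lookup; concat)
open import Data.List.Relation.Unary.All using (All)
open import Data.List.Relation.Unary.Unique.Propositional using (Unique)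
open import Data.List.Membership.Propositional using (_∈_)
open import Data.Product using (_×_)
open import Data.Sum using (_⊎_)
open import Relation.Nullary using (¬_)
open import Relation.Binary.PropositionalEquality using (_≡_; _≢_)
open import Level using (0ℓ; suc)

record Tournament (n : ℕ) : Set₁ where
  field
    _⇒_      : Fin n → Fin n → Set
    irrefl   : ∀ x → ¬ (x ⇒ x)
    total    : ∀ x y → x ≢ y → (x ⇒ y) ⊎ (y ⇒ x)
    asym     : ∀ x y → x ⇒ y → ¬ (y ⇒ x)

open Tournament public

IsPathPower : ∀ {n} → Tournament n → ℕ → List (Fin n) → Set
IsPathPower T k xs =
  Unique xs ×
  (xs ≢ []) ×
  (∀ (i j : Fin (length xs)) → toℕ i < toℕ j → toℕ j ≤ toℕ i + k →
     _⇒_ T (lookup xs i) (lookup xs j))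

IsPathPowerPartition : ∀ {n} → Tournament n → ℕ → List (List (Fin n)) → Set
IsPathPowerPartition {n} T k P =
  All (IsPathPower T k) P ×
  Unique (concat P) ×
  (∀ (v : Fin n) → v ∈ concat P)

{-# OPTIONS --safe #-}
module Submission where

-- A chain is a sequence of transitive blocks of size at least 4k, each dominating the next one; blocks of
-- size 8k are fat. Take a chain with the maximal number of fat blocks. Every other vertex v has a gap
-- whose preceding block contains 2k in-neighbours and whose following block contains 2k out-neighbours
-- of v, by a discrete intermediate value argument. Fewer than ρ = 2^(40k) vertices share a gap: among
-- more, pigeonhole and Ramsey's theorem give three fat blocks that could be inserted into the chain at
-- the expense of two. A chain with at most one extra vertex in each gap is covered by three k-th powers
-- of paths running in parallel. Remove ρ maximal chains one after the other. Each remaining vertex has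
-- a gap in all ρ chains, and each gap belongs to at most ρ vertices, so by Hall's theorem the remaining
-- vertices can be assigned to distinct gaps, and 3ρ powers of paths suffice.

open import Defs
open import Data.Nat using (ℕ; _≤_; _^_; _*_; NonZero)
open import Data.List using (List; length)
open import Data.Fin using (Fin)
open import Data.Product using (Σ; _×_)

open import Data.Bool using (if_then_else_)
open import Data.Fin using (zero; suc; toℕ)
import Data.Fin.Properties as Fin
open import Data.List using ([]; _∷_; [_]; filter; _++_; map; concat; _ʳ++_; take; lookup; allFin)
open import Data.List.Membership.Propositional using (_∈_; _∉_; find; lose)
open import Data.List.Membership.Propositional.Properties
open import Data.List.Properties
  using (length-++; length-map; length-filter; filter-accept; filter-reject; concat-++)
  renaming (++-assoc to ++-assoc≡; ++-identityʳ to ++-identityʳ≡)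
open import Data.List.Relation.Binary.Permutation.Propositional
open import Data.List.Relation.Binary.Permutation.Propositional.Properties
open import Data.List.Relation.Unary.All using (All; []; _∷_; all?)
import Data.List.Relation.Unary.All as All
import Data.List.Relation.Unary.All.Properties as All
open import Data.List.Relation.Unary.AllPairs using (AllPairs; []; _∷_)
import Data.List.Relation.Unary.AllPairs.Properties as AllPairs
open import Data.List.Relation.Unary.Any using (here; there; any?)
open import Data.List.Relation.Unary.Unique.Propositional using (Unique)
open import Data.List.Relation.Unary.Unique.Propositional.Properties using (Unique[x∷xs]⇒x∉xs; allFin⁺)
open import Data.Nat
  using (zero; suc; pred; _+_; _<_; _≤?_; _<?_; z≤n; s≤s; s≤s⁻¹; _≟_; >-nonZero; ≢-nonZero; >-nonZero⁻¹)
open import Data.Nat.Properties hiding (_≟_; _≤?_; _<?_)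
open import Data.Nat.Tactic.RingSolver using (solve-∀)
open import Data.Product using (∃; _,_; proj₁; proj₂)
open import Data.Product.Properties using (≡-dec)
open import Data.Sum using (_⊎_; inj₁; inj₂)
open import Data.Unit using (⊤; tt)
open import Function using (_∘_; flip)
open import Relation.Binary.Definitions using (DecidableEquality)
open import Relation.Binary.PropositionalEquality using (_≡_; _≢_; refl; sym; cong; cong₂; subst)
import Relation.Binary.PropositionalEquality as ≡
open import Relation.Nullary using (¬_; Dec; yes; no; contradiction; ¬?; _×-dec_; does)
open import Relation.Unary using (Decidable)
open import Relation.Unary.Properties using (∁?)
open import Data.List.Membership.DecPropositional (≡-dec _≟_ _≟_) using (_∈?_)

-- Counting and Ramsey arguments for lists

module _ {A : Set} where

  count : {P : A → Set} → Decidable P → List A → ℕ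
  count P? xs = length (filter P? xs)

  AllPairs-++⁻ : {R : A → A → Set} (xs : List A) {ys : List A} → AllPairs R (xs ++ ys) →
                 AllPairs R xs × AllPairs R ys × (∀ {x y} → x ∈ xs → y ∈ ys → R x y)
  AllPairs-++⁻ [] rs = [] , rs , λ ()
  AllPairs-++⁻ (x ∷ xs) (r ∷ rs) with AllPairs-++⁻ xs rs
  ... | rs₁ , rs₂ , cross = All.++⁻ˡ xs r ∷ rs₁ , rs₂ , λ where
    (here refl) y∈ → All.lookup (All.++⁻ʳ xs r) y∈
    (there x∈)  y∈ → cross x∈ y∈

  Unique-↭ : {xs ys : List A} → xs ↭ ys → Unique xs → Unique ys
  Unique-↭ {xs} {ys} p = Unique-resp-↭ (↭⇒↭ₛ p)
    where open import Data.List.Relation.Binary.Permutation.Setoid.Properties (≡.setoid A)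

  module _ {P : A → Set} (P? : Decidable P) where

    filter-↭-∁ : ∀ xs → xs ↭ filter P? xs ++ filter (∁? P?) xs
    filter-↭-∁ [] = ↭-refl
    filter-↭-∁ (x ∷ xs) with P? x
    ... | yes _ = prep x (filter-↭-∁ xs)
    ... | no  _ = ↭-trans (prep x (filter-↭-∁ xs)) (↭-sym (shift x (filter P? xs) _))

    count-++ : ∀ xs ys → count P? (xs ++ ys) ≡ count P? xs + count P? ys
    count-++ [] ys = refl
    count-++ (x ∷ xs) ys with P? x
    ... | yes _ = cong suc (count-++ xs ys)
    ... | no  _ = count-++ xs ys

    count-↭ : ∀ {xs ys} → xs ↭ ys → count P? xs ≡ count P? ys
    count-↭ p = ↭-length (filter-↭ P? p)

    count-∁ : ∀ xs → length xs ≡ count P? xs + count (∁? P?) xs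
    count-∁ xs = ≡.trans (↭-length (filter-↭-∁ xs)) (length-++ (filter P? xs))

    count-++ˡ : ∀ xs ys → count P? xs ≤ count P? (xs ++ ys)
    count-++ˡ xs ys = ≤-trans (m≤m+n _ _) (≤-reflexive (sym (count-++ xs ys)))

    count-++ʳ : ∀ xs ys → count P? ys ≤ count P? (xs ++ ys)
    count-++ʳ xs ys = ≤-trans (m≤n+m _ _) (≤-reflexive (sym (count-++ xs ys)))

    count-all : ∀ {xs} → (∀ {x} → x ∈ xs → P x) → count P? xs ≡ length xs
    count-all {[]} h = refl
    count-all {x ∷ xs} h with P? x
    ... | yes _ = cong suc (count-all (h ∘ there))
    ... | no ¬p = contradiction (h (here refl)) ¬p

    count-accept : ∀ x xs → P x → count P? (x ∷ xs) ≡ suc (count P? xs)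
    count-accept x xs p = cong length (filter-accept P? p)

    count-reject : ∀ x xs → ¬ P x → count P? (x ∷ xs) ≡ count P? xs
    count-reject x xs ¬p = cong length (filter-reject P? ¬p)

    count>0 : ∀ {xs} → 0 < count P? xs → ∃ λ x → x ∈ xs × P x
    count>0 {xs} c with filter P? xs in eq
    ... | y ∷ _ = y , ∈-filter⁻ P? (subst (y ∈_) (sym eq) (here refl))

  module _ {P Q : A → Set} (P? : Decidable P) (Q? : Decidable Q) where

    count-filter : ∀ xs → count P? (filter Q? xs) ≤ count P? xs
    count-filter xs = ≤-trans (count-++ˡ P? (filter Q? xs) _)
      (≤-reflexive (sym (count-↭ P? (filter-↭-∁ Q? xs))))

    count-⊆ : ∀ xs → (∀ {x} → x ∈ xs → P x → Q x) → count P? xs ≤ count Q? xs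
    count-⊆ [] h = z≤n
    count-⊆ (x ∷ xs) h with P? x | Q? x
    ... | yes _ | yes _ = s≤s (count-⊆ xs (h ∘ there))
    ... | yes p | no ¬q = contradiction (h (here refl) p) ¬q
    ... | no _  | yes _ = m≤n⇒m≤1+n (count-⊆ xs (h ∘ there))
    ... | no _  | no _  = count-⊆ xs (h ∘ there)

    count-∪ : ∀ xs → (∀ {x} → x ∈ xs → P x ⊎ Q x) → length xs ≤ count P? xs + count Q? xs
    count-∪ [] h = z≤n
    count-∪ (x ∷ xs) h with P? x | Q? x | h (here refl)
    ... | yes _ | yes _ | _ = s≤s (≤-trans (count-∪ xs (h ∘ there)) (+-monoʳ-≤ _ (n≤1+n _)))
    ... | yes _ | no _  | _ = s≤s (count-∪ xs (h ∘ there))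
    ... | no _  | yes _ | _ = ≤-trans (s≤s (count-∪ xs (h ∘ there))) (≤-reflexive (sym (+-suc _ _)))
    ... | no ¬p | no ¬q | inj₁ p = contradiction p ¬p
    ... | no ¬p | no ¬q | inj₂ q = contradiction q ¬q

  count-⊎ : {P Q S : A → Set} (P? : Decidable P) (Q? : Decidable Q) (S? : Decidable S) →
            (∀ {x} → P x → S x) → (∀ {x} → Q x → S x) → (∀ {x} → P x → ¬ Q x) →
            ∀ xs → count P? xs + count Q? xs ≤ count S? xs
  count-⊎ P? Q? S? p⇒s q⇒s dis [] = z≤n
  count-⊎ P? Q? S? p⇒s q⇒s dis (x ∷ xs) with P? x | Q? x | S? x | count-⊎ P? Q? S? p⇒s q⇒s dis xs
  ... | yes p | yes q | _     | _  = contradiction q (dis p)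
  ... | yes p | no _  | no ¬s | _  = contradiction (p⇒s p) ¬s
  ... | no _  | yes q | no ¬s | _  = contradiction (q⇒s q) ¬s
  ... | yes _ | no _  | yes _ | ih = s≤s ih
  ... | no _  | yes _ | yes _ | ih = ≤-trans (≤-reflexive (+-suc _ _)) (s≤s ih)
  ... | no _  | no _  | yes _ | ih = m≤n⇒m≤1+n ih
  ... | no _  | no _  | no _  | ih = ih

  fibres-bound : {B : Set} (_≟_ : DecidableEquality B) (g : A → B) {r : ℕ} (xs : List A) (ps : List B) →
                 (∀ {x} → x ∈ xs → g x ∈ ps) →
                 (∀ p → count (λ x → g x ≟ p) xs ≤ r) →
                 length xs ≤ length ps * r
  fibres-bound _≟_ g [] [] h b = z≤n
  fibres-bound _≟_ g (x ∷ xs) [] h b with () ← h (here refl)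
  fibres-bound _≟_ g {r} xs (p ∷ ps) h b = begin
    length xs                                          ≡⟨ count-∁ p? xs ⟩
    count p? xs + count (∁? p?) xs                     ≤⟨ +-mono-≤ (b p) (fibres-bound _≟_ g _ ps h′ b′) ⟩
    r + length ps * r                                  ∎
    where
    open ≤-Reasoning
    p? = λ x → g x ≟ p
    h′ : ∀ {x} → x ∈ filter (∁? p?) xs → g x ∈ ps
    h′ x∈ with ∈-filter⁻ (∁? p?) x∈
    ... | x∈xs , gx≢p with h x∈xs
    ... | here eq = contradiction eq gx≢p
    ... | there q = q
    b′ : ∀ q → count (λ x → g x ≟ q) (filter (∁? p?) xs) ≤ r
    b′ q = ≤-trans (count-filter _ (∁? p?) xs) (b q)

  -- If both parts had fewer than `m` entries, the length would be at most `m + m` minus two. The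
  -- slack `suc` accounts for the pivot that `transitive-sublist` has removed.
  majority : {P : A → Set} (P? : Decidable P) (m : ℕ) (xs : List A) → m + m ≤ suc (length xs) →
             m ≤ count P? xs ⊎ m ≤ count (∁? P?) xs
  majority P? m xs h with m ≤? count P? xs | m ≤? count (∁? P?) xs
  ... | yes p | _     = inj₁ p
  ... | no _  | yes q = inj₂ q
  ... | no ¬p | no ¬q = contradiction h (<⇒≱ (begin-strict
    suc (length xs)                             ≡⟨ cong suc (count-∁ P? xs) ⟩
    suc (count P? xs + count (∁? P?) xs)        <⟨ s≤s (≤-reflexive (sym (+-suc _ _))) ⟩
    suc (count P? xs) + suc (count (∁? P?) xs)  ≤⟨ +-mono-≤ (≰⇒> ¬p) (≰⇒> ¬q) ⟩
    m + m                                       ∎))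
    where open ≤-Reasoning

  -- Pigeonhole on traces: each `y` in `ys` splits the surviving vertices in two, and keeping the
  -- larger half costs a factor 2 per entry of `ys`.
  homogeneous : {D : A → A → Set} (D? : ∀ x y → Dec (D x y)) (ys : List A) (r : ℕ) (xs : List A) →
                r * 2 ^ length ys ≤ length xs →
                ∃ λ xs′ → ∃ λ rest → ∃ λ zs → xs ↭ xs′ ++ rest × r ≤ length xs′ ×
                  (∀ {x} → x ∈ xs′ → filter (D? x) ys ≡ zs)
  homogeneous D? [] r xs h =
    xs , [] , [] , ↭-sym (++-identityʳ xs) , subst (_≤ length xs) (*-identityʳ r) h , λ _ → refl
  homogeneous D? (y ∷ ys) r xs h
    with homogeneous D? ys (r + r) xs (subst (_≤ length xs) (double (2 ^ length ys)) h)
    where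
    double : ∀ q → r * (2 * q) ≡ (r + r) * q
    double = distribute r
      where
      distribute : ∀ r q → r * (2 * q) ≡ (r + r) * q
      distribute = solve-∀
  ... | ws , rest , zs , p , rr , eqs
    with majority (λ x → D? x y) r ws (m≤n⇒m≤1+n rr)
  ... | inj₁ big = _ , _ , y ∷ zs ,
    ↭-trans p (↭-trans (++⁺ʳ rest (filter-↭-∁ y? ws)) (++-assoc (filter y? ws) _ rest)) , big ,
    λ x∈ → let x∈ws , d = ∈-filter⁻ y? x∈ in ≡.trans (filter-accept (D? _) d) (cong (y ∷_) (eqs x∈ws))
    where y? = λ x → D? x y
  ... | inj₂ big = _ , _ , zs ,
    ↭-trans p (↭-trans (++⁺ʳ rest (↭-trans (filter-↭-∁ y? ws) (++-comm (filter y? ws) _)))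
                       (++-assoc (filter (∁? y?) ws) _ rest)) , big ,
    λ x∈ → let x∈ws , d = ∈-filter⁻ (∁? y?) x∈ in ≡.trans (filter-reject (D? _) d) (eqs x∈ws)
    where y? = λ x → D? x y

  -- The Ramsey argument for tournaments: recurse into the larger of the out- and in-neighbourhoods
  -- of the first vertex, which then goes to the front or to the end.
  transitive-sublist : {E : A → A → Set} (E? : ∀ x y → Dec (E x y)) (tot : ∀ {x y} → x ≢ y → E x y ⊎ E y x) →
                       (d : ℕ) (xs : List A) → Unique xs → 2 ^ d ≤ length xs →
                       ∃ λ ys → ∃ λ rest → xs ↭ ys ++ rest × AllPairs E ys × length ys ≡ d
  transitive-sublist E? tot zero xs u h = [] , xs , ↭-refl , [] , refl
  transitive-sublist E? tot (suc d) [] u h = contradiction h (<⇒≱ (m^n>0 2 (suc d)))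
  transitive-sublist {E} E? tot (suc d) (x ∷ xs) (x∉ ∷ u) h
    with majority (E? x) (2 ^ d) xs (subst (_≤ suc (length xs)) (cong (2 ^ d +_) (+-identityʳ _)) h)
  ... | inj₁ big with transitive-sublist E? tot d (filter (E? x) xs) (AllPairs.filter⁺ (E? x) u) big
  ... | ys , rest , p , t , len = x ∷ ys , rest ++ filter (∁? (E? x)) xs ,
        prep x (↭-trans (filter-↭-∁ (E? x) xs) (↭-trans (++⁺ʳ _ p) (++-assoc ys rest _))) ,
        All.++⁻ˡ ys (All-resp-↭ p (All.all-filter (E? x) xs)) ∷ t , cong suc len
  transitive-sublist {E} E? tot (suc d) (x ∷ xs) (x∉ ∷ u) h | inj₂ big
    with transitive-sublist E? tot d (filter (∁? (E? x)) xs) (AllPairs.filter⁺ (∁? (E? x)) u) big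
  ... | ys , rest , p , t , len = ys ++ [ x ] , rest ++ filter (E? x) xs ,
        ↭-trans (prep x (↭-trans (filter-↭-∁ (E? x) xs) (↭-trans (++-comm (filter (E? x) xs) _) (++⁺ʳ _ p))))
          (↭-trans (↭-reflexive (cong (x ∷_) (++-assoc≡ ys rest _)))
            (↭-trans (↭-sym (shift x ys _)) (↭-sym (++-assoc ys [ x ] _)))) ,
        AllPairs.++⁺ t ([] ∷ []) (All.map (_∷ []) (All.++⁻ˡ ys (All-resp-↭ p into))) ,
        ≡.trans (length-++ ys) (≡.trans (+-comm _ 1) (cong suc len))
    where
    into : All (λ y → E y x) (filter (∁? (E? x)) xs)
    into = All.tabulate λ y∈ → let y∈xs , ¬e = ∈-filter⁻ (∁? (E? x)) y∈ in
      case-tot ¬e (tot (All.lookup x∉ y∈xs))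
      where
      case-tot : ∀ {y} → ¬ E x y → E x y ⊎ E y x → E y x
      case-tot ¬e (inj₁ e) = contradiction e ¬e
      case-tot ¬e (inj₂ e) = e

  split : ∀ m {n} (xs : List A) → length xs ≡ m + n →
          ∃ λ ys → ∃ λ zs → xs ≡ ys ++ zs × length ys ≡ m × length zs ≡ n
  split zero xs eq = [] , xs , refl , refl , eq
  split (suc m) (x ∷ xs) eq with split m xs (suc-injective eq)
  ... | ys , zs , refl , e₁ , e₂ = x ∷ ys , zs , refl , cong suc e₁ , e₂

  record TransitiveTriple (E : A → A → Set) (m : ℕ) (xs : List A) : Set where
    field
      {G₁ G₂ G₃ rest}  : List A
      xs↭              : xs ↭ (G₁ ++ G₂ ++ G₃) ++ rest
      transitive       : AllPairs E (G₁ ++ G₂ ++ G₃)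
      len₁             : length G₁ ≡ m
      len₂             : length G₂ ≡ m
      len₃             : length G₃ ≡ m

  transitive-triple : {E : A → A → Set} (E? : ∀ x y → Dec (E x y)) (tot : ∀ {x y} → x ≢ y → E x y ⊎ E y x) →
                      (m : ℕ) (xs : List A) → Unique xs → 2 ^ (m + (m + m)) ≤ length xs → TransitiveTriple E m xs
  transitive-triple E? tot m xs u big with transitive-sublist E? tot (m + (m + m)) xs u big
  ... | G , _ , xs↭ , tr , lenG with split m G lenG
  ... | G₁ , G₂₃ , refl , len₁ , len₂₃ with split m G₂₃ len₂₃
  ... | G₂ , G₃ , refl , len₂ , len₃ = record
    { G₁ = G₁ ; G₂ = G₂ ; G₃ = G₃ ; xs↭ = xs↭ ; transitive = tr ; len₁ = len₁ ; len₂ = len₂ ; len₃ = len₃ }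

-- Matchings of vertices to slots

-- Averaging over the first `m` rows with denominators cleared: if none of them has fewer than
-- `l / r` entries, together they have at least `m * l / r`.
sparse-row : (l r m : ℕ) (bs : List (ℕ × ℕ)) →
             (∃ λ i → i < m × count (λ b → proj₁ b ≟ i) bs * r < l) ⊎ m * l ≤ count (λ b → proj₁ b <? m) bs * r
sparse-row l r zero bs = inj₂ z≤n
sparse-row l r (suc m) bs with count (λ b → proj₁ b ≟ m) bs * r <? l | sparse-row l r m bs
... | yes c | _ = inj₁ (m , ≤-refl , c)
... | no _  | inj₁ (i , i<m , c) = inj₁ (i , m≤n⇒m≤1+n i<m , c)
... | no ¬c | inj₂ h = inj₂ (begin
  l + m * l                                     ≤⟨ +-mono-≤ (≮⇒≥ ¬c) h ⟩
  #eq * r + #lt * r                             ≡⟨ *-distribʳ-+ r #eq #lt ⟨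
  (#eq + #lt) * r                               ≤⟨ *-monoˡ-≤ r (add bs) ⟩
  count (λ b → proj₁ b <? suc m) bs * r         ∎)
  where
  open ≤-Reasoning
  #eq = count (λ b → proj₁ b ≟ m) bs
  #lt = count (λ b → proj₁ b <? m) bs
  add : ∀ bs → count (λ b → proj₁ b ≟ m) bs + count (λ b → proj₁ b <? m) bs ≤ count (λ b → proj₁ b <? suc m) bs
  add bs = count-⊎ (λ b → proj₁ b ≟ m) (λ b → proj₁ b <? m) (λ b → proj₁ b <? suc m)
    (λ where refl → ≤-refl) m≤n⇒m≤1+n (λ where refl lt → n≮n _ lt) bs

-- The bipartite graph joins `x` to the slots `(i , s i x)` with `i < m`. Each vertex has degree `m`
-- and each slot degree at most `r ≤ m`, which gives Hall's condition. A matching is encoded by the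
-- row `a x` alone.
module Hall {A : Set} (_≟A_ : DecidableEquality A) (s : ℕ → A → ℕ) (m r : ℕ) (r≤m : r ≤ m) (0<m : 0 < m) where

  σ : (A → ℕ) → A → ℕ × ℕ
  σ a x = a x , s (a x) x

  Loads : List A → Set
  Loads xs = ∀ {i} → i < m → ∀ p → count (λ x → s i x ≟ p) xs ≤ r

  -- Some row i contains at most a fraction 1 / m of the slots bs, hence cannot host all of ws.
  fresh-slot : ∀ ws (bs : List (ℕ × ℕ)) → Loads ws → length bs < length ws →
               ∃ λ w → ∃ λ i → w ∈ ws × i < m × (i , s i w) ∉ bs
  fresh-slot ws bs load lt with sparse-row (length ws) r m bs
  ... | inj₂ h = contradiction h (<⇒≱ (begin-strict
    count (λ b → proj₁ b <? m) bs * r  ≤⟨ *-monoˡ-≤ r (length-filter (λ b → proj₁ b <? m) bs) ⟩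
    length bs * r                      ≤⟨ *-monoʳ-≤ (length bs) r≤m ⟩
    length bs * m                      ≡⟨ *-comm (length bs) m ⟩
    m * length bs                      <⟨ *-monoʳ-< m {{>-nonZero 0<m}} lt ⟩
    m * length ws                      ∎))
    where open ≤-Reasoning
  ... | inj₁ (i , i<m , c) with any? (λ w → ¬? ((i , s i w) ∈? bs)) ws
  ... | yes e = let w , w∈ , ∉bs = find e in w , i , w∈ , i<m , ∉bs
  ... | no ¬e = contradiction bound (<⇒≱ c)
    where
    row = filter (λ b → proj₁ b ≟ i) bs
    in-row : ∀ {w} → w ∈ ws → s i w ∈ map proj₂ row
    in-row {w} w∈ with (i , s i w) ∈? bs
    ... | yes b∈ = ∈-map⁺ proj₂ (∈-filter⁺ (λ b → proj₁ b ≟ i) b∈ refl)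
    ... | no ∉bs = contradiction (lose w∈ ∉bs) ¬e
    bound : length ws ≤ length row * r
    bound = subst (λ l → length ws ≤ l * r) (length-map proj₂ row)
      (fibres-bound _≟_ (s i) ws (map proj₂ row) in-row (load i<m))

  Valid : (A → ℕ) → List A → Set
  Valid a xs = (∀ {x} → x ∈ xs → a x < m) ×
               (∀ {x y} → x ∈ xs → y ∈ xs → σ a x ≡ σ a y → x ≡ y)

  _[_↦_] : (A → ℕ) → A → ℕ → A → ℕ
  (b [ w ↦ i ]) x = if does (x ≟A w) then i else b x

  ↦-≡ : ∀ b w i → (b [ w ↦ i ]) w ≡ i
  ↦-≡ b w i with w ≟A w
  ... | yes _ = refl
  ... | no ne = contradiction refl ne

  ↦-≢ : ∀ b w i {x} → x ≢ w → (b [ w ↦ i ]) x ≡ b x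
  ↦-≢ b w i {x} ne with x ≟A w
  ... | yes e = contradiction e ne
  ... | no _  = refl

  σ-↦-≡ : ∀ b w i → σ (b [ w ↦ i ]) w ≡ (i , s i w)
  σ-↦-≡ b w i = cong (λ j → j , s j w) (↦-≡ b w i)

  σ-↦-≢ : ∀ b w i {x} → x ≢ w → σ (b [ w ↦ i ]) x ≡ σ b x
  σ-↦-≢ b w i {x} ne = cong (λ j → j , s j x) (↦-≢ b w i ne)

  module Augment (a : A → ℕ) (v : A) (xs : List A) (u : Unique (v ∷ xs))
                 (a-ok : Valid a xs) (load : Loads (v ∷ xs)) where

    -- The set v ∷ ws is explored along alternating paths from v: for each of its members w there is
    -- an assignment that leaves only w unmatched and, on the explored set, uses only slots taken by ws.
    record Spare (ws rest : List A) (w : A) : Set where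
      field
        b     : A → ℕ
        agree : ∀ {x} → x ∈ rest → b x ≡ a x
        range : ∀ {x} → x ∈ v ∷ ws → x ≢ w → b x < m × σ b x ∈ map (σ a) ws
        inj   : ∀ {x y} → x ∈ v ∷ ws → y ∈ v ∷ ws → x ≢ w → y ≢ w → σ b x ≡ σ b y → x ≡ y

    open Spare

    -- A fresh slot of an explored vertex is either free, which completes the assignment, or held by
    -- some `x` in `rest`, which then joins the explored set. The bound `l` on the length of `rest`
    -- gives termination.
    augment : ∀ l ws rest → length rest ≤ l → xs ↭ ws ++ rest → (∀ {w} → w ∈ v ∷ ws → Spare ws rest w) →
              ∃ λ b → Valid b (v ∷ xs)
    augment l ws rest rest≤l p spare
      with fresh-slot (v ∷ ws) (map (σ a) ws) loadW (s≤s (≤-reflexive (length-map (σ a) ws)))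
      where
      loadW : Loads (v ∷ ws)
      loadW {i} i<m q = begin
        count s? (v ∷ ws)              ≤⟨ count-++ˡ s? (v ∷ ws) rest ⟩
        count s? (v ∷ ws ++ rest)      ≡⟨ count-↭ s? (prep v p) ⟨
        count s? (v ∷ xs)              ≤⟨ load i<m q ⟩
        r                              ∎
        where open ≤-Reasoning
              s? = λ x → s i x ≟ q
    ... | w , i , w∈ , i<m , ∉ws with (i , s i w) ∈? map (σ a) rest
    -- The slot is free: start from the assignment that spares `w` and give this slot to `w`.
    ... | no ∉rest = b′ , b′<m , b′-inj
      where
      sp = spare w∈
      b′ = b sp [ w ↦ i ]
      ∈xsˡ : ∀ {x} → x ∈ ws → x ∈ xs
      ∈xsˡ x∈ = ∈-resp-↭ (↭-sym p) (∈-++⁺ˡ x∈)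
      ∈xsʳ : ∀ {x} → x ∈ rest → x ∈ xs
      ∈xsʳ x∈ = ∈-resp-↭ (↭-sym p) (∈-++⁺ʳ ws x∈)
      disjoint : ∀ {x y} → x ∈ ws → y ∈ rest → x ≢ y
      disjoint = proj₂ (proj₂ (AllPairs-++⁻ ws (Unique-↭ p (proj₁ (proj₂ (AllPairs-++⁻ [ v ] u))))))
      data Place (x : A) : Set where
        isW    : x ≡ w → Place x
        found  : x ∈ v ∷ ws → x ≢ w → Place x
        remain : x ∈ rest → x ≢ w → Place x
      place : ∀ {x} → x ∈ v ∷ xs → Place x
      place {x} x∈ with x ≟A w
      ... | yes eq = isW eq
      ... | no ne with ∈-++⁻ (v ∷ ws) (∈-resp-↭ (prep v p) x∈)
      ... | inj₁ q = found q ne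
      ... | inj₂ q = remain q ne
      σ-w : σ b′ w ≡ (i , s i w)
      σ-w = σ-↦-≡ (b sp) w i
      σ-found : ∀ {x} → x ≢ w → σ b′ x ≡ σ (b sp) x
      σ-found ne = σ-↦-≢ (b sp) w i ne
      σ-remain : ∀ {x} → x ∈ rest → x ≢ w → σ b′ x ≡ σ a x
      σ-remain x∈ ne = ≡.trans (σ-found ne) (cong (λ j → j , s j _) (agree sp x∈))
      w≢found : ∀ {x} → x ∈ v ∷ ws → x ≢ w → σ b′ w ≢ σ b′ x
      w≢found x∈ ne eq = ∉ws (subst (_∈ map (σ a) ws)
        (≡.trans (sym (σ-found ne)) (≡.trans (sym eq) σ-w)) (proj₂ (range sp x∈ ne)))
      w≢remain : ∀ {x} → x ∈ rest → x ≢ w → σ b′ w ≢ σ b′ x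
      w≢remain x∈ ne eq = ∉rest (subst (_∈ map (σ a) rest)
        (≡.trans (sym (σ-remain x∈ ne)) (≡.trans (sym eq) σ-w)) (∈-map⁺ (σ a) x∈))
      found≢remain : ∀ {x y} → x ∈ v ∷ ws → x ≢ w → y ∈ rest → y ≢ w → σ b′ x ≢ σ b′ y
      found≢remain x∈ nex y∈ ney eq with ∈-map⁻ (σ a) (proj₂ (range sp x∈ nex))
      ... | z , z∈ , eq′ = disjoint z∈ y∈ (proj₂ a-ok (∈xsˡ z∈) (∈xsʳ y∈)
        (≡.trans (sym eq′) (≡.trans (sym (σ-found nex)) (≡.trans eq (σ-remain y∈ ney)))))
      b′<m : ∀ {x} → x ∈ v ∷ xs → b′ x < m
      b′<m x∈ with place x∈
      ... | isW refl    = subst (_< m) (sym (↦-≡ (b sp) w i)) i<m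
      ... | found q ne  = subst (_< m) (sym (↦-≢ (b sp) w i ne)) (proj₁ (range sp q ne))
      ... | remain q ne = subst (_< m) (sym (≡.trans (↦-≢ (b sp) w i ne) (agree sp q))) (proj₁ a-ok (∈xsʳ q))
      b′-inj : ∀ {x y} → x ∈ v ∷ xs → y ∈ v ∷ xs → σ b′ x ≡ σ b′ y → x ≡ y
      b′-inj x∈ y∈ eq with place x∈ | place y∈
      ... | isW refl    | isW refl      = refl
      ... | isW refl    | found q ne    = contradiction eq (w≢found q ne)
      ... | isW refl    | remain q ne   = contradiction eq (w≢remain q ne)
      ... | found q ne  | isW refl      = contradiction (sym eq) (w≢found q ne)
      ... | remain q ne | isW refl      = contradiction (sym eq) (w≢remain q ne)
      ... | found q ne  | remain q′ ne′ = contradiction eq (found≢remain q ne q′ ne′)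
      ... | remain q ne | found q′ ne′  = contradiction (sym eq) (found≢remain q′ ne′ q ne)
      ... | found q ne  | found q′ ne′  =
        inj sp q q′ ne ne′ (≡.trans (sym (σ-found ne)) (≡.trans eq (σ-found ne′)))
      ... | remain q ne | remain q′ ne′ =
        proj₂ a-ok (∈xsʳ q) (∈xsʳ q′) (≡.trans (sym (σ-remain q ne)) (≡.trans eq (σ-remain q′ ne′)))
    ... | yes ∈rest with ∈-map⁻ (σ a) ∈rest
    ... | x , x∈ , σx≡ with ∈-∃++ x∈
    augment zero ws .(r₁ ++ [ x ] ++ r₂) rest≤l p spare
      | _ | yes _ | x , _ | r₁ , r₂ , refl
      = contradiction (subst (_≤ 0) (↭-length (shift x r₁ r₂)) rest≤l) λ ()
    augment (suc l) ws .(r₁ ++ [ x ] ++ r₂) rest≤l p spare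
      | w , i , w∈ , i<m , ∉ws | yes ∈rest | x , x∈ , σx≡ | r₁ , r₂ , refl
      = augment l (x ∷ ws) (r₁ ++ r₂)
          (s≤s⁻¹ (≤-trans (≤-reflexive (sym (↭-length (shift x r₁ r₂)))) rest≤l)) p′ spare′
      where
      ws′ = x ∷ ws
      rest′ = r₁ ++ r₂
      p′ : xs ↭ ws′ ++ rest′
      p′ = ↭-trans p (↭-trans (++⁺ˡ ws (shift x r₁ r₂)) (shift x ws rest′))
      v∉ : v ∉ xs
      v∉ = Unique[x∷xs]⇒x∉xs u
      u′ : Unique (ws′ ++ rest′)
      u′ = Unique-↭ p′ (proj₁ (proj₂ (AllPairs-++⁻ [ v ] u)))
      ∈xs : ∀ {y} → y ∈ ws′ → y ∈ xs
      ∈xs y∈ = ∈-resp-↭ (↭-sym p′) (∈-++⁺ˡ y∈)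
      ∈v∷ws : ∀ {y} → y ∈ v ∷ ws′ → y ≢ x → y ∈ v ∷ ws
      ∈v∷ws (here eq) _ = here eq
      ∈v∷ws (there (here eq)) ne = contradiction eq ne
      ∈v∷ws (there (there q)) _ = there q
      old∈rest : ∀ {y} → y ∈ rest′ → y ∈ r₁ ++ [ x ] ++ r₂
      old∈rest y∈ = ∈-resp-↭ (↭-sym (shift x r₁ r₂)) (there y∈)
      σx∉ws : σ a x ∉ map (σ a) ws
      σx∉ws q = ∉ws (subst (_∈ map (σ a) ws) (sym σx≡) q)
      x∈rest : x ∈ r₁ ++ [ x ] ++ r₂
      x∈rest = ∈-resp-↭ (↭-sym (shift x r₁ r₂)) (here refl)
      disj-v : ∀ {y z} → y ∈ v ∷ ws → z ∈ rest′ → y ≢ z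
      disj-v (here refl) z∈ refl = v∉ (∈-resp-↭ (↭-sym p′) (∈-++⁺ʳ ws′ z∈))
      disj-v (there q)   z∈      = proj₂ (proj₂ (AllPairs-++⁻ ws′ u′)) (there q) z∈
      rest≢w : ∀ {y} → y ∈ rest′ → y ≢ w
      rest≢w y∈ refl = disj-v w∈ y∈ refl
      spare′ : ∀ {y} → y ∈ v ∷ ws′ → Spare ws′ rest′ y
      spare′ {y} y∈ with y ≟A x
      -- The assignment that spared `y` before still works: `x` keeps its slot under `a`, which no
      -- explored vertex occupies because it is the fresh one.
      ... | no y≢x = record
        { b = b sp
        ; agree = agree sp ∘ old∈rest
        ; range = range′
        ; inj = inj′ }
        where
        sp = spare (∈v∷ws y∈ y≢x)
        σsp≡ : σ (b sp) x ≡ σ a x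
        σsp≡ = cong (λ j → j , s j x) (agree sp x∈rest)
        range′ : ∀ {z} → z ∈ v ∷ ws′ → z ≢ y → b sp z < m × σ (b sp) z ∈ map (σ a) ws′
        range′ {z} z∈ z≢y with z ≟A x
        ... | yes refl = subst (_< m) (sym (agree sp x∈rest)) (proj₁ a-ok (∈xs (here refl))) , here σsp≡
        ... | no z≢x = let lt , q = range sp (∈v∷ws z∈ z≢x) z≢y in lt , there q
        inj′ : ∀ {z z′} → z ∈ v ∷ ws′ → z′ ∈ v ∷ ws′ → z ≢ y → z′ ≢ y → σ (b sp) z ≡ σ (b sp) z′ → z ≡ z′
        inj′ {z} {z′} z∈ z′∈ z≢ z′≢ eq with z ≟A x | z′ ≟A x
        ... | yes refl | yes refl = refl
        ... | yes refl | no ne = contradiction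
          (subst (_∈ map (σ a) ws) (≡.trans (sym eq) σsp≡) (proj₂ (range sp (∈v∷ws z′∈ ne) z′≢))) σx∉ws
        ... | no ne | yes refl = contradiction
          (subst (_∈ map (σ a) ws) (≡.trans eq σsp≡) (proj₂ (range sp (∈v∷ws z∈ ne) z≢))) σx∉ws
        ... | no ne | no ne′ = inj sp (∈v∷ws z∈ ne) (∈v∷ws z′∈ ne′) z≢ z′≢ eq
      -- To spare `x` instead of `w`, hand the slot of `x` over to `w`.
      ... | yes refl = record
        { b = b′
        ; agree = λ q → ≡.trans (↦-≢ (b sp) w i (rest≢w q)) (agree sp (old∈rest q))
        ; range = range′
        ; inj = inj′ }
        where
        sp = spare w∈
        b′ = b sp [ w ↦ i ]
        range′ : ∀ {z} → z ∈ v ∷ ws′ → z ≢ x → b′ z < m × σ b′ z ∈ map (σ a) ws′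
        range′ {z} z∈ z≢x with z ≟A w
        ... | yes refl = i<m , here σx≡
        ... | no z≢w = let lt , q = range sp (∈v∷ws z∈ z≢x) z≢w in lt , there q
        inj′ : ∀ {z z′} → z ∈ v ∷ ws′ → z′ ∈ v ∷ ws′ → z ≢ x → z′ ≢ x → σ b′ z ≡ σ b′ z′ → z ≡ z′
        inj′ {z} {z′} z∈ z′∈ z≢ z′≢ eq with z ≟A w | z′ ≟A w
        ... | yes refl | yes refl = refl
        ... | yes refl | no ne = contradiction
          (subst (_∈ map (σ a) ws) (sym eq) (proj₂ (range sp (∈v∷ws z′∈ z′≢) ne))) ∉ws
        ... | no ne | yes refl = contradiction
          (subst (_∈ map (σ a) ws) eq (proj₂ (range sp (∈v∷ws z∈ z≢) ne))) ∉ws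
        ... | no ne | no ne′ = inj sp (∈v∷ws z∈ z≢) (∈v∷ws z′∈ z′≢) ne ne′ eq

  matching : ∀ xs → Unique xs → Loads xs → ∃ λ a → Valid a xs
  matching [] u load = (λ _ → 0) , (λ ()) , λ ()
  matching (v ∷ xs) u@(_ ∷ u′) load
    with matching xs u′ (λ {i} i<m p → ≤-trans (count-++ʳ (λ x → s i x ≟ p) [ v ] xs) (load i<m p))
  -- The exploration starts from `v` alone, so there is nothing to match yet on the explored set.
  ... | a , a-ok = augment (length xs) [] xs ≤-refl ↭-refl λ where
      (here refl) → record
        { b = a ; agree = λ _ → refl
        ; range = λ { (here refl) ne → contradiction refl ne }
        ; inj = λ { (here refl) _ ne → contradiction refl ne } }
    where open Augment a v xs u a-ok load

-- Chains of transitive blocks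

module Chains {A : Set} (E : A → A → Set) (E? : ∀ x y → Dec (E x y))
              (tot : ∀ {x y} → x ≢ y → E x y ⊎ E y x) (k : ℕ) (0<k : 0 < k) where

  c2 c4 c8 : ℕ
  c2 = k + k
  c4 = c2 + c2
  c8 = c4 + c4

  Block : Set
  Block = List A

  hd : List Block → Block
  hd []      = []
  hd (B ∷ _) = B

  Complete : (A → A → Set) → Block → Block → Set
  Complete D B C = ∀ {x y} → x ∈ B → y ∈ C → D x y

  -- Blocks are always ordered by `E`, while the relation `D` between neighbouring blocks is a
  -- parameter: the part of a chain to the left of a gap is stored in reverse, with `D = flip E`.
  IsChain : (A → A → Set) → List Block → Set
  IsChain D []       = ⊤
  IsChain D (B ∷ bs) = AllPairs E B × c4 ≤ length B × Complete D B (hd bs) × IsChain D bs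

  -- The size is exact because recording traces on a fat block costs 2 to the power of its length.
  -- Half of a fat block, `c4`, is still an admissible block.
  Fat : Block → Set
  Fat B = length B ≡ c8

  fat? : Decidable Fat
  fat? B = length B ≟ c8

  fats : List Block → ℕ
  fats = count fat?

  module _ {D : A → A → Set} (D? : ∀ x y → Dec (D x y)) (w : A) where

    -- The first fat block of the list, if there is one, contains many D-neighbours of w.
    data Side : List Block → Set where
      end  : Side []
      fat  : ∀ {B bs} → Fat B → c4 ≤ count (D? w) B → Side (B ∷ bs)
      thin : ∀ {B bs} → ¬ Fat B → Side bs → Side (B ∷ bs)

    side? : Decidable Side
    side? [] = yes end
    side? (B ∷ bs) with fat? B | c4 ≤? count (D? w) B | side? bs
    ... | yes f | yes c | _     = yes (fat f c)
    ... | yes f | no ¬c | _     = no λ { (fat _ c) → ¬c c ; (thin ¬f _) → ¬f f }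
    ... | no ¬f | _     | yes s = yes (thin ¬f s)
    ... | no ¬f | _     | no ¬s = no λ { (fat f _) → ¬f f ; (thin _ s) → ¬s s }

  record Trimmed (D : A → A → Set) (bs : List Block) (r : ℕ) (ws : List A) : Set where
    field
      blocks   : List Block
      dropped  : List A
      kept     : List A
      rejected : List A
      ws↭      : ws ↭ kept ++ rejected
      many     : r ≤ length kept
      chain    : IsChain D blocks
      adjacent : Complete D kept (hd blocks)
      fats≤    : fats bs ≤ suc (fats blocks)
      bs↭      : concat bs ↭ concat blocks ++ dropped

  -- Thin blocks are dropped up to the first fat one, which is replaced by the trace shared by many
  -- vertices of `ws`. By `Side` this trace has `c4` elements, so it is a block again; at most one
  -- fat block is lost.
  trim : {D : A → A → Set} (D? : ∀ x y → Dec (D x y)) (bs : List Block) (r : ℕ) (ws : List A) →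
         0 < r → IsChain D bs → (∀ {w} → w ∈ ws → Side D? w bs) → r * 2 ^ c8 ≤ length ws →
         Trimmed D bs r ws
  trim D? [] r ws 0<r _ _ big = record
    { blocks = [] ; dropped = [] ; kept = ws ; rejected = []
    ; ws↭ = ↭-sym (++-identityʳ ws)
    ; many = ≤-trans (m≤m*n r (2 ^ c8) {{m^n≢0 2 c8}}) big
    ; chain = tt ; adjacent = λ _ () ; fats≤ = z≤n ; bs↭ = ↭-refl }
  trim D? (B ∷ bs) r ws 0<r (trans-B , _ , B⇒bs , ch) sides big with fat? B
  ... | no ¬f = record
    { Trimmed t hiding (fats≤; bs↭; dropped)
    ; dropped = Trimmed.dropped t ++ B
    ; fats≤ = ≤-trans (≤-reflexive (count-reject fat? B bs ¬f)) (Trimmed.fats≤ t)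
    ; bs↭ = ↭-trans (++-comm B _) (↭-trans (++⁺ʳ B (Trimmed.bs↭ t)) (++-assoc (concat (Trimmed.blocks t)) _ B)) }
    where
    next : ∀ {w} → Side D? w (B ∷ bs) → Side D? w bs
    next (fat f _)  = contradiction f ¬f
    next (thin _ s) = s
    t = trim D? bs r ws 0<r ch (next ∘ sides) big
  ... | yes f with homogeneous D? B r ws (subst (λ l → r * 2 ^ l ≤ length ws) (sym f) big)
  ... | [] , _ , _ , _ , r≤ , _ = contradiction 0<r (≤⇒≯ r≤)
  -- Since `0 < r`, some vertex `w` survives, and the common trace `Y` is its neighbourhood in `B`.
  ... | w ∷ kept , rejected , Y , p , r≤ , eqs = record
    { blocks = Y ∷ bs ; dropped = filter (∁? (D? w)) B ; kept = w ∷ kept ; rejected = rejected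
    ; ws↭ = p ; many = r≤
    ; chain = subst (AllPairs E) (eqs (here refl)) (AllPairs.filter⁺ (D? w) trans-B) ,
              subst (λ Z → c4 ≤ length Z) (eqs (here refl)) (enough (sides (∈-resp-↭ (↭-sym p) (here refl)))) ,
              (λ y∈ → B⇒bs (proj₁ (∈-filter⁻ (D? w) (subst (_ ∈_) (sym (eqs (here refl))) y∈)))) , ch
    ; adjacent = λ x∈ y∈ → proj₂ (∈-filter⁻ (D? _) {xs = B} (subst (_ ∈_) (sym (eqs x∈)) y∈))
    ; fats≤ = ≤-trans (≤-reflexive (count-accept fat? B bs f)) (s≤s (count-++ʳ fat? [ Y ] bs))
    ; bs↭ = ↭-trans (++⁺ʳ (concat bs) (↭-trans (filter-↭-∁ (D? w) B) (++⁺ʳ _ (↭-reflexive (eqs (here refl))))))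
              (↭-trans (++-assoc Y _ _) (↭-trans (++⁺ˡ Y (++-comm _ (concat bs))) (↭-sym (++-assoc Y _ _)))) }
    where
    enough : ∀ {w} → Side D? w (B ∷ bs) → c4 ≤ count (D? w) B
    enough (fat _ c)   = c
    enough (thin ¬f _) = contradiction f ¬f

  chain-ʳ++ : ∀ ls rs → IsChain (flip E) ls → IsChain E rs → Complete E (hd ls) (hd rs) → IsChain E (ls ʳ++ rs)
  chain-ʳ++ [] rs _ ch _ = ch
  chain-ʳ++ (B ∷ ls) rs (t , l , c , chl) ch B⇒rs =
    chain-ʳ++ ls (B ∷ rs) chl (t , l , B⇒rs , ch) (λ x∈ y∈ → c y∈ x∈)

  concat-ʳ++ : ∀ (ls rs : List Block) → concat (ls ʳ++ rs) ↭ concat ls ++ concat rs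
  concat-ʳ++ [] rs = ↭-refl
  concat-ʳ++ (B ∷ ls) rs = ↭-trans (concat-ʳ++ ls (B ∷ rs))
    (↭-trans (shifts (concat ls) B) (↭-sym (++-assoc B _ _)))

  fats-ʳ++ : ∀ ls rs → fats (ls ʳ++ rs) ≡ fats ls + fats rs
  fats-ʳ++ ls rs = ≡.trans (sym (count-↭ fat? (++↭ʳ++ ls rs))) (count-++ fat? ls rs)

  -- The slot of w is the gap it can be inserted in: the first gap that is followed by a block with c2
  -- out-neighbours and, at or after that block, by a fat block with c4 of them before any other fat one.
  -- The last block before the gap then has c2 in-neighbours and the last fat one c4 (see in-or-out);
  -- the larger bound at fat blocks lets improve shrink them to blocks that are still admissible.
  Here : A → Block → List Block → Set
  Here w B bs = Side E? w (B ∷ bs) × c2 ≤ count (E? w) B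

  here? : ∀ w B bs → Dec (Here w B bs)
  here? w B bs = side? E? w (B ∷ bs) ×-dec (c2 ≤? count (E? w) B)

  slot : A → List Block → ℕ
  slot w [] = 0
  slot w (B ∷ bs) with here? w B bs
  ... | yes _ = 0
  ... | no _  = suc (slot w bs)

  E˘? : ∀ x y → Dec (E y x)
  E˘? x y = E? y x

  in-or-out : ∀ w B m → w ∉ B → m + m ≤ length B → ¬ (m ≤ count (E? w) B) → m ≤ count (E˘? w) B
  in-or-out w B m w∉ big ¬out = +-cancelˡ-≤ m m _ (begin
    m + m                                  ≤⟨ big ⟩
    length B                               ≤⟨ count-∪ (E? w) (E˘? w) B (λ x∈ → tot λ { refl → w∉ x∈ }) ⟩
    count (E? w) B + count (E˘? w) B       ≤⟨ +-monoˡ-≤ _ (<⇒≤ (≰⇒> ¬out)) ⟩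
    m + count (E˘? w) B                    ∎)
    where open ≤-Reasoning

  -- The chain is cut at the gap shared by all of `ws`, with the left part reversed, so that `trim`
  -- can work outwards from the gap on both sides.
  record Zipper (bs : List Block) (ws : List A) : Set where
    field
      {left right} : List Block
      bs≡    : left ʳ++ right ≡ bs
      chainˡ : IsChain (flip E) left
      chainʳ : IsChain E right
      sideˡ  : ∀ {w} → w ∈ ws → Side E˘? w left
      sideʳ  : ∀ {w} → w ∈ ws → Side E? w right

  -- The cut moves right across `p` blocks. A vertex passes a fat block only if it has fewer than
  -- `c4` out-neighbours there, hence at least `c4` in-neighbours, so the left side condition is
  -- preserved; thin blocks do not affect it.
  zipper : ∀ p ls rs ws → IsChain (flip E) ls → IsChain E rs → Complete E (hd ls) (hd rs) →
           (∀ {w} → w ∈ ws → Side E˘? w ls × slot w rs ≡ p × w ∉ concat rs) → Zipper (ls ʳ++ rs) ws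
  zipper zero ls rs ws chl chr _ h = record
    { bs≡ = refl ; chainˡ = chl ; chainʳ = chr ; sideˡ = proj₁ ∘ h
    ; sideʳ = λ w∈ → zero-side rs (proj₁ (proj₂ (h w∈))) }
    where
    zero-side : ∀ {w} rs → slot w rs ≡ 0 → Side E? w rs
    zero-side [] _ = end
    zero-side {w} (B ∷ rs) eq with here? w B rs
    ... | yes (s , _) = s
  -- The chain can end before slot `p` is reached only when `ws` is empty, because `slot w []` is 0.
  zipper (suc p) ls [] [] chl chr _ h = record
    { bs≡ = refl ; chainˡ = chl ; chainʳ = chr ; sideˡ = λ () ; sideʳ = λ () }
  zipper (suc p) ls [] (w ∷ ws) chl chr _ h with () ← proj₁ (proj₂ (h (here refl)))
  zipper (suc p) ls (B ∷ rs) ws chl (t , l , B⇒rs , chr) ls⇒B h =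
    zipper p (B ∷ ls) rs ws (t , l , (λ x∈ y∈ → ls⇒B y∈ x∈) , chl) chr B⇒rs step
    where
    step : ∀ {w} → w ∈ ws → Side E˘? w (B ∷ ls) × slot w rs ≡ p × w ∉ concat rs
    step {w} w∈ with here? w B rs | h w∈
    ... | no ¬h | s , eq , w∉ = side , suc-injective eq , w∉ ∘ ∈-++⁺ʳ B
      where
      side : Side E˘? w (B ∷ ls)
      side with fat? B
      ... | no ¬f = thin ¬f s
      ... | yes f = fat f (in-or-out w B c4 (w∉ ∘ ∈-++⁺ˡ) (≤-reflexive (sym f))
                             λ out → ¬h (fat f out , ≤-trans (m≤m+n c2 c2) out))

  -- The factors 2 ^ c8 pay for the trace of a vertex on each of two fat blocks, g for three new fat ones.
  g ρ : ℕ
  g = 2 ^ (c8 + (c8 + c8))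
  ρ = g * 2 ^ c8 * 2 ^ c8

  0<g : 0 < g
  0<g = m^n>0 2 (c8 + (c8 + c8))

  0<ρ : 0 < ρ
  0<ρ = *-mono-≤ (*-mono-≤ 0<g (m^n>0 2 c8)) (m^n>0 2 c8)

  slot-is? : ∀ bs p → Decidable (λ w → slot w bs ≡ p)
  slot-is? bs p w = slot w bs ≟ p

  record Improvement (us : List A) (bs : List Block) : Set where
    field
      blocks  : List Block
      outside : List A
      us↭     : us ↭ concat blocks ++ outside
      chain   : IsChain E blocks
      fats<   : fats bs < fats blocks

  -- The two fat blocks around an overloaded gap shrink to common neighbourhoods of many of its vertices,
  -- the thin blocks between them are dropped, and three fat blocks of such vertices take their place.
  improve : ∀ {us} bs vs p → Unique us → us ↭ concat bs ++ vs → IsChain E bs →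
            ρ ≤ count (slot-is? bs p) vs →
            Improvement us bs
  improve {us} bs vs p u us↭ ch big = record
    { blocks = bs′ ; outside = vs′ ; us↭ = us↭′ ; chain = ch′ ; fats< = fats< }
    where
    open import Algebra.Solver.CommutativeMonoid (++-commutativeMonoid {A = A}) using (solve; _⊕_; _⊜_)
    ws = filter (slot-is? bs p) vs
    u′ : Unique (concat bs ++ vs)
    u′ = Unique-↭ us↭ u
    outside : ∀ {w} → w ∈ ws → w ∉ concat bs
    outside w∈ w∈bs = proj₂ (proj₂ (AllPairs-++⁻ (concat bs) u′)) w∈bs (proj₁ (∈-filter⁻ (slot-is? bs p) w∈)) refl
    z : Zipper bs ws
    z = zipper p [] bs ws tt ch (λ ()) λ w∈ → end , proj₂ (∈-filter⁻ (slot-is? bs p) {xs = vs} w∈) , outside w∈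
    open Zipper z
    -- The two trimmings are nested: the right one leaves `g * 2 ^ c8` vertices of `ws`, and the
    -- left one leaves `g` of these, which are therefore compatible with both sides.
    module R = Trimmed (trim E? right (g * 2 ^ c8) ws (*-mono-≤ 0<g (m^n>0 2 c8)) chainʳ sideʳ big)
    module L = Trimmed (trim E˘? left g R.kept 0<g chainˡ
                          (λ w∈ → sideˡ (∈-resp-↭ (↭-sym R.ws↭) (∈-++⁺ˡ w∈))) R.many)
    uws : Unique ws
    uws = AllPairs.filter⁺ (slot-is? bs p) (proj₁ (proj₂ (AllPairs-++⁻ (concat bs) u′)))
    uL : Unique L.kept
    uL = proj₁ (AllPairs-++⁻ L.kept (Unique-↭ L.ws↭ (proj₁ (AllPairs-++⁻ R.kept (Unique-↭ R.ws↭ uws)))))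
    -- The number `g` is just enough for a transitive set of `3 * c8` vertices, which is cut into
    -- three consecutive fat blocks.
    open TransitiveTriple (transitive-triple E? tot c8 L.kept uL L.many) renaming (xs↭ to G↭; transitive to trG)
    rs = G₁ ∷ G₂ ∷ G₃ ∷ R.blocks
    bs′ = L.blocks ʳ++ rs
    vs′ = L.dropped ++ R.dropped ++ rest ++ L.rejected ++ R.rejected ++ filter (∁? (slot-is? bs p)) vs
    us↭′ : us ↭ concat bs′ ++ vs′
    us↭′ = begin
      us                                                             ↭⟨ us↭ ⟩
      concat bs ++ vs                                                ≡⟨ cong (λ z → concat z ++ vs) (sym bs≡) ⟩
      concat (left ʳ++ right) ++ vs
        ↭⟨ ++⁺ (concat-ʳ++ left right) (filter-↭-∁ (slot-is? bs p) vs) ⟩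
      (concat left ++ concat right) ++ ws ++ others
        ↭⟨ ++⁺ (++⁺ L.bs↭ R.bs↭) (++⁺ʳ others (↭-trans R.ws↭ (++⁺ʳ R.rejected
             (↭-trans L.ws↭ (++⁺ʳ L.rejected G↭))))) ⟩
      ((concat L.blocks ++ L.dropped) ++ (concat R.blocks ++ R.dropped))
        ++ ((((G₁ ++ G₂ ++ G₃) ++ rest) ++ L.rejected) ++ R.rejected) ++ others
        ↭⟨ solve 11 (λ l ld r rd g₁ g₂ g₃ re lr rr o →
              ((l ⊕ ld) ⊕ (r ⊕ rd)) ⊕ ((((g₁ ⊕ (g₂ ⊕ g₃)) ⊕ re) ⊕ lr) ⊕ rr) ⊕ o ⊜
              (l ⊕ (g₁ ⊕ (g₂ ⊕ (g₃ ⊕ r)))) ⊕ (ld ⊕ (rd ⊕ (re ⊕ (lr ⊕ (rr ⊕ o)))))) ↭-refl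
              (concat L.blocks) L.dropped (concat R.blocks) R.dropped G₁ G₂ G₃ rest L.rejected R.rejected others ⟩
      (concat L.blocks ++ concat rs) ++ vs′                          ↭⟨ ++⁺ʳ vs′ (↭-sym (concat-ʳ++ L.blocks rs)) ⟩
      concat bs′ ++ vs′                                              ∎
      where open PermutationReasoning
            others = filter (∁? (slot-is? bs p)) vs
    G⊆ : ∀ {x} → x ∈ G₁ ++ G₂ ++ G₃ → x ∈ L.kept
    G⊆ x∈ = ∈-resp-↭ (↭-sym G↭) (∈-++⁺ˡ x∈)
    long : ∀ {B} → length B ≡ c8 → c4 ≤ length B
    long eq = ≤-trans (m≤m+n c4 c4) (≤-reflexive (sym eq))
    tr₁ = AllPairs-++⁻ G₁ trG
    tr₂ = AllPairs-++⁻ G₂ (proj₁ (proj₂ tr₁))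
    ch′ : IsChain E bs′
    ch′ = chain-ʳ++ L.blocks rs L.chain
      ( proj₁ tr₁ , long {G₁} len₁ , (λ x∈ y∈ → proj₂ (proj₂ tr₁) x∈ (∈-++⁺ˡ y∈))
      , proj₁ tr₂ , long {G₂} len₂ , proj₂ (proj₂ tr₂)
      , proj₁ (proj₂ tr₂) , long {G₃} len₃
      , (λ x∈ y∈ → R.adjacent (∈-resp-↭ (↭-sym L.ws↭) (∈-++⁺ˡ (G⊆ (∈-++⁺ʳ G₁ (∈-++⁺ʳ G₂ x∈))))) y∈)
      , R.chain)
      (λ x∈ y∈ → L.adjacent (G⊆ (∈-++⁺ˡ y∈)) x∈)
    fats-rs : fats rs ≡ 3 + fats R.blocks
    fats-rs = ≡.trans (count-accept fat? G₁ _ len₁) (cong suc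
      (≡.trans (count-accept fat? G₂ _ len₂) (cong suc (count-accept fat? G₃ _ len₃))))
    fats< : fats bs < fats bs′
    fats< = begin-strict
      fats bs                                        ≡⟨ cong fats bs≡ ⟨
      fats (left ʳ++ right)                          ≡⟨ fats-ʳ++ left right ⟩
      -- Each trimming costs at most one fat block, against the three that are gained.
      fats left + fats right                         ≤⟨ +-mono-≤ L.fats≤ R.fats≤ ⟩
      suc (fats L.blocks) + suc (fats R.blocks)      <⟨ ≤-refl ⟩
      suc (suc (fats L.blocks) + suc (fats R.blocks)) ≡⟨ cong suc (+-suc (suc (fats L.blocks)) (fats R.blocks)) ⟩
      3 + (fats L.blocks + fats R.blocks)            ≡⟨ +-comm 3 (fats L.blocks + fats R.blocks) ⟩
      fats L.blocks + fats R.blocks + 3              ≡⟨ +-assoc (fats L.blocks) (fats R.blocks) 3 ⟩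
      fats L.blocks + (fats R.blocks + 3)            ≡⟨ cong (fats L.blocks +_) (+-comm (fats R.blocks) 3) ⟩
      fats L.blocks + (3 + fats R.blocks)            ≡⟨ cong (fats L.blocks +_) fats-rs ⟨
      fats L.blocks + fats rs                        ≡⟨ fats-ʳ++ L.blocks rs ⟨
      fats bs′                                       ∎
      where open ≤-Reasoning

  fats≤length : ∀ {D} bs → IsChain D bs → fats bs ≤ length (concat bs)
  fats≤length [] _ = z≤n
  fats≤length (B ∷ bs) (_ , l , _ , ch) = begin
    fats (B ∷ bs)                    ≡⟨ count-++ fat? [ B ] bs ⟩
    fats [ B ] + fats bs             ≤⟨ +-mono-≤ (length-filter fat? [ B ]) (fats≤length bs ch) ⟩
    1 + length (concat bs)           ≤⟨ +-monoˡ-≤ _ (≤-trans 0<k (≤-trans (m≤m+n k k) (≤-trans (m≤m+n c2 c2) l))) ⟩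
    length B + length (concat bs)    ≡⟨ length-++ B ⟨
    length (B ++ concat bs)          ∎
    where open ≤-Reasoning

  record Maximal (us : List A) : Set where
    field
      blocks  : List Block
      outside : List A
      us↭     : us ↭ concat blocks ++ outside
      chain   : IsChain E blocks
      load    : ∀ p → count (slot-is? blocks p) outside ≤ ρ

  -- Improvements are iterated. Blocks are nonempty and disjoint, so there are never more fat blocks
  -- than vertices, and `length us` rounds suffice.
  maximal : ∀ us → Unique us → Maximal us
  maximal us u = go (length us) [] us ↭-refl tt (m≤n+m _ 0)
    where
    go : ∀ f bs vs → us ↭ concat bs ++ vs → IsChain E bs → length us ≤ fats bs + f → Maximal us
    -- It is enough to test the slots of actual vertices: an overloaded slot contains one, since
    -- `0 < ρ`.
    go f bs vs us↭ ch enough with any? (λ v → ρ ≤? count (slot-is? bs (slot v bs)) vs) vs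
    ... | no ¬any = record { blocks = bs ; outside = vs ; us↭ = us↭ ; chain = ch ; load = λ p → <⇒≤ (load p) }
      where
      load : ∀ p → count (slot-is? bs p) vs < ρ
      load p = ≰⇒> λ big → let v , v∈ , eq = count>0 (slot-is? bs p) (≤-trans 0<ρ big) in
        ¬any (lose v∈ (subst (λ q → ρ ≤ count (slot-is? bs q) vs) (sym eq) big))
    ... | yes any = further f enough
      where
      module I = Improvement (improve bs vs _ u us↭ ch (proj₂ (proj₂ (find any))))
      open ≤-Reasoning
      further : ∀ f → length us ≤ fats bs + f → Maximal us
      -- There are already as many fat blocks as vertices, so a further improvement is impossible.
      further zero    enough = contradiction I.fats< (≤⇒≯ (begin
        fats I.blocks                                ≤⟨ fats≤length I.blocks I.chain ⟩
        length (concat I.blocks)                     ≤⟨ m≤m+n _ _ ⟩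
        length (concat I.blocks) + length I.outside  ≡⟨ length-++ (concat I.blocks) ⟨
        length (concat I.blocks ++ I.outside)        ≡⟨ ↭-length I.us↭ ⟨
        length us                                    ≤⟨ enough ⟩
        fats bs + 0                                  ≡⟨ +-identityʳ _ ⟩
        fats bs                                      ∎))
      further (suc f) enough = go f I.blocks I.outside I.us↭ I.chain (begin
        length us             ≤⟨ enough ⟩
        fats bs + suc f       ≡⟨ +-suc (fats bs) f ⟩
        suc (fats bs) + f     ≤⟨ +-monoˡ-≤ f I.fats< ⟩
        fats I.blocks + f     ∎)

  -- Here `B` is the block just before gap 0, and `p` counts gaps to the right from there. The gap
  -- after the last block has no right neighbour, hence no condition on out-neighbours.
  Fits : Block → List Block → A → ℕ → Set
  Fits B []       v p       = p ≡ 0 × c2 ≤ count (E˘? v) B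
  Fits B (C ∷ bs) v zero    = c2 ≤ count (E˘? v) B × c2 ≤ count (E? v) C
  Fits B (C ∷ bs) v (suc p) = Fits C bs v p

  FitsFront : List Block → A → ℕ → Set
  FitsFront []       v p       = p ≡ 0
  FitsFront (B ∷ bs) v zero    = c2 ≤ count (E? v) B
  FitsFront (B ∷ bs) v (suc p) = Fits B bs v p

  -- The step of the discrete intermediate value argument: a thin block inherits the side condition
  -- from `bs`, so only a lack of `c2` out-neighbours can rule out `Here`; for a fat block it is a
  -- lack of `c4`. Both bounds are at most half the block, so the in-neighbours make up for it.
  pass : ∀ {D} w B bs → IsChain D (B ∷ bs) → w ∉ B → ¬ Here w B bs → Side E? w bs → c2 ≤ count (E˘? w) B
  pass w B bs (_ , l , _) w∉ ¬h s with fat? B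
  ... | no ¬f = in-or-out w B c2 w∉ l λ out → ¬h (thin ¬f s , out)
  ... | yes f = ≤-trans (m≤m+n c2 c2) (in-or-out w B c4 w∉ (≤-reflexive (sym f))
                  λ out → ¬h (fat f out , ≤-trans (m≤m+n c2 c2) out))

  -- The hypothesis on `B` is what `pass` yields for the block just passed. Its premise `Side`
  -- becomes available where the search stops, from `Here` or from `end`.
  slot-fits : ∀ {D} w B bs → IsChain D bs → w ∉ concat bs → (Side E? w bs → c2 ≤ count (E˘? w) B) →
              Fits B bs w (slot w bs)
  slot-fits w B [] _ _ ins = refl , ins end
  slot-fits w B (C ∷ bs) ch w∉ ins with here? w C bs
  ... | yes (s , out) = ins s , out
  ... | no ¬h = slot-fits w C bs (proj₂ (proj₂ (proj₂ ch))) (w∉ ∘ ∈-++⁺ʳ C) (pass w C bs ch (w∉ ∘ ∈-++⁺ˡ) ¬h)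

  slot-fits-front : ∀ {D} w bs → IsChain D bs → w ∉ concat bs → FitsFront bs w (slot w bs)
  slot-fits-front w [] _ _ = refl
  slot-fits-front w (B ∷ bs) ch w∉ with here? w B bs
  ... | yes (_ , out) = out
  ... | no ¬h = slot-fits w B bs (proj₂ (proj₂ (proj₂ ch))) (w∉ ∘ ∈-++⁺ʳ B) (pass w B bs ch (w∉ ∘ ∈-++⁺ˡ) ¬h)

-- Covering chains by powers of paths

count≤1 : {A : Set} {P : A → Set} (P? : Decidable P) (xs : List A) → Unique xs →
          (∀ {x y} → x ∈ xs → y ∈ xs → P x → P y → x ≡ y) → count P? xs ≤ 1
count≤1 P? xs u same with filter P? xs in eq | AllPairs.filter⁺ P? u
... | [] | _ = z≤n
... | _ ∷ [] | _ = ≤-refl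
... | x ∷ y ∷ _ | (x≢y ∷ _) ∷ _ = contradiction (same x∈ y∈ Px Py) x≢y
  where
  mx = ∈-filter⁻ P? (subst (x ∈_) (sym eq) (here refl))
  my = ∈-filter⁻ P? (subst (y ∈_) (sym eq) (there (here refl)))
  x∈ = proj₁ mx
  y∈ = proj₁ my
  Px = proj₂ mx
  Py = proj₂ my

≤1⇒AllPairs : {A : Set} {R : A → A → Set} (xs : List A) → length xs ≤ 1 → AllPairs R xs
≤1⇒AllPairs [] _ = []
≤1⇒AllPairs (x ∷ []) _ = [] ∷ []
≤1⇒AllPairs (_ ∷ _ ∷ _) (s≤s ())

module Lanes {A : Set} (_≟A_ : DecidableEquality A) (E : A → A → Set) (E? : ∀ x y → Dec (E x y))
              (tot : ∀ {x y} → x ≢ y → E x y ⊎ E y x) (k : ℕ) (0<k : 0 < k) where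
  open Chains E E? tot k 0<k

  Power : List A → Set
  Power []       = ⊤
  Power (x ∷ xs) = All (E x) (take k xs) × Power xs

  transitive-Power : ∀ {xs} → AllPairs E xs → Power xs
  transitive-Power []       = tt
  transitive-Power (r ∷ rs) = All.take⁺ k r , transitive-Power rs

  All-take-++ : {P : A → Set} (m : ℕ) (xs : List A) {ys : List A} →
                m ≤ length xs → All P xs → All P (take m (xs ++ ys))
  All-take-++ zero    xs       _       _        = []
  All-take-++ (suc m) (x ∷ xs) (s≤s h) (p ∷ ps) = p ∷ All-take-++ m xs h ps

  -- As `hs` has at least `k` entries, the next `k` entries after one of `xs` never reach `ts`.
  join : ∀ {xs} hs {ts} → AllPairs E xs → Complete E xs hs → k ≤ length hs → Power (hs ++ ts) →
         Power (xs ++ hs ++ ts)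
  join hs [] _ _ pw = pw
  join {x ∷ xs} hs {ts} (r ∷ rs) c h pw =
    subst (λ l → All (E x) (take k l)) (++-assoc≡ xs hs ts)
      (All-take-++ k (xs ++ hs) (≤-trans h (≤-trans (m≤n+m _ _) (≤-reflexive (sym (length-++ xs)))))
        (All.++⁺ r (All.tabulate (c (here refl)))))
    , join hs rs (c ∘ there) h pw

  pick : {P : A → Set} (P? : Decidable P) (j : ℕ) (B : Block) → AllPairs E B → j ≤ count P? B →
         ∃ λ Y → ∃ λ rest → B ↭ Y ++ rest × AllPairs E Y × AllPairs E rest × length Y ≡ j × All P Y
  pick P? zero B tr h = [] , B , ↭-refl , [] , tr , refl , []
  pick P? (suc j) (x ∷ B) (r ∷ tr) h with P? x
  ... | yes px with pick P? j B tr (s≤s⁻¹ h)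
  ... | Y , rest , p , trY , trR , len , ps =
    x ∷ Y , rest , prep x p , All.++⁻ˡ Y (All-resp-↭ p r) ∷ trY , trR , cong suc len , px ∷ ps
  pick P? (suc j) (x ∷ B) (r ∷ tr) h | no _ with pick P? (suc j) B tr h
  ... | Y , rest , p , trY , trR , len , ps =
    Y , x ∷ rest , ↭-trans (prep x p) (↭-sym (shift x Y rest)) , trY , All.++⁻ʳ Y (All-resp-↭ p r) ∷ trR , len , ps

  record Division (P Q : A → Set) (B : Block) : Set where
    field
      {Y X Z}     : List A
      B↭          : B ↭ Y ++ X ++ Z
      trY         : AllPairs E Y
      trX         : AllPairs E X
      trZ         : AllPairs E Z
      |Y|         : k ≤ length Y
      |X|         : k ≤ length X
      |Z|         : k ≤ length Z
      allY        : All P Y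
      allX        : All Q X
    ∈Y : ∀ {x} → x ∈ Y → x ∈ B
    ∈Y x∈ = ∈-resp-↭ (↭-sym B↭) (∈-++⁺ˡ x∈)
    ∈X : ∀ {x} → x ∈ X → x ∈ B
    ∈X x∈ = ∈-resp-↭ (↭-sym B↭) (∈-++⁺ʳ Y (∈-++⁺ˡ x∈))
    ∈Z : ∀ {x} → x ∈ Z → x ∈ B
    ∈Z x∈ = ∈-resp-↭ (↭-sym B↭) (∈-++⁺ʳ Y (∈-++⁺ʳ X x∈))

  -- Only `k` vertices are taken for `Y`, so at least `k` of the `c2` vertices satisfying `Q` remain
  -- for `X`, and `Z` still gets at least `c4` minus `c2` vertices.
  divide : {P Q : A → Set} (P? : Decidable P) (Q? : Decidable Q) (B : Block) → AllPairs E B →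
           c4 ≤ length B → c2 ≤ count P? B → c2 ≤ count Q? B → Division P Q B
  divide P? Q? B tr big hP hQ with pick P? k B tr (≤-trans (m≤m+n k k) hP)
  ... | Y , rest , p , trY , trR , lenY , allY with pick Q? k rest trR enough
    where
    enough : k ≤ count Q? rest
    enough = +-cancelˡ-≤ k k _ (begin
      k + k                          ≤⟨ hQ ⟩
      count Q? B                     ≡⟨ ≡.trans (count-↭ Q? p) (count-++ Q? Y rest) ⟩
      count Q? Y + count Q? rest     ≤⟨ +-monoˡ-≤ (count Q? rest) (length-filter Q? Y) ⟩
      length Y + count Q? rest       ≡⟨ cong (_+ count Q? rest) lenY ⟩
      k + count Q? rest              ∎)
      where open ≤-Reasoning
  ... | X , Z , q , trX , trZ , lenX , allX = record
    { B↭ = ↭-trans p (++⁺ˡ Y q) ; trY = trY ; trX = trX ; trZ = trZ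
    ; |Y| = ≤-reflexive (sym lenY) ; |X| = ≤-reflexive (sym lenX) ; |Z| = ≤-trans (m≤m+n k k) big′
    ; allY = allY ; allX = allX }
    where
    open ≤-Reasoning
    big′ : k + k ≤ length Z
    big′ = +-cancelˡ-≤ (k + k) (k + k) _ (begin
      (k + k) + (k + k)                  ≤⟨ big ⟩
      length B                           ≡⟨ ↭-length p ⟩
      length (Y ++ rest)                 ≡⟨ length-++ Y ⟩
      length Y + length rest             ≡⟨ cong₂ _+_ lenY (≡.trans (↭-length q)
                                              (≡.trans (length-++ X) (cong (_+ length Z) lenX))) ⟩
      k + (k + length Z)                 ≡⟨ +-assoc k k (length Z) ⟨
      (k + k) + length Z                 ∎)

  All? : {D : A → A → Set} (D? : ∀ x y → Dec (D x y)) (vs : List A) → Decidable (λ x → All (λ v → D v x) vs)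
  All? D? vs x = all? (λ v → D? v x) vs

  -- An optional vertex in a gap is encoded as a list of length at most 1. Its common neighbourhood
  -- is all of `B` or the neighbourhood of a single vertex.
  common : {D : A → A → Set} (D? : ∀ x y → Dec (D x y)) (m : ℕ) (vs : List A) (B : Block) →
           length vs ≤ 1 → m ≤ length B →
           (∀ {v} → v ∈ vs → m ≤ count (D? v) B) → m ≤ count (All? D? vs) B
  common D? m [] B _ big _ = ≤-trans big (≤-reflexive (sym (count-all (All? D? []) {B} λ _ → [])))
  common D? m (v ∷ []) B _ _ h = ≤-trans (h (here refl)) (count-⊆ (D? v) (All? D? (v ∷ [])) B λ _ d → d ∷ [])
  common D? m (_ ∷ _ ∷ _) B (s≤s ()) _ _

  -- What is put in front of a lane interacts only with the first `k` vertices, so it is enough to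
  -- know `P` on a head of that length.
  record Lane (P : A → Set) (L : List A) : Set where
    field
      head tail : List A
      L≡        : L ≡ head ++ tail
      long      : k ≤ length head
      headP     : ∀ {x} → x ∈ head → P x
      power     : Power L

  extend : {P Q : A → Set} {xs L : List A} → AllPairs E xs → k ≤ length xs → (∀ {x} → x ∈ xs → P x) →
           Lane Q L → (∀ {x y} → x ∈ xs → Q y → E x y) → Lane P (xs ++ L)
  extend {xs = xs} tr big hP record { head = h ; tail = t ; L≡ = refl ; long = l ; headP = hQ ; power = pw } c = record
    { head = xs ; tail = _ ; L≡ = refl ; long = big ; headP = hP
    ; power = join h tr (λ x∈ y∈ → c x∈ (hQ y∈)) l pw }

  prepend : {P Q : A → Set} {vs L : List A} → length vs ≤ 1 → Lane Q L → (∀ {v y} → v ∈ vs → Q y → E v y) →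
            (∀ {v} → v ∈ vs → P v) → (∀ {y} → Q y → P y) → Lane P (vs ++ L)
  prepend {vs = vs} ≤1 record { head = h ; tail = t ; L≡ = refl ; long = l ; headP = hQ ; power = pw } c pv q⇒p = record
    { head = vs ++ h ; tail = t ; L≡ = sym (++-assoc≡ vs h t)
    ; long = ≤-trans l (≤-trans (m≤n+m _ _) (≤-reflexive (sym (length-++ vs))))
    ; headP = λ x∈ → case (∈-++⁻ vs x∈)
    ; power = join h (≤1⇒AllPairs vs ≤1) (λ x∈ y∈ → c x∈ (hQ y∈)) l pw }
    where
    case : ∀ {x} → x ∈ vs ⊎ x ∈ h → _
    case (inj₁ x∈) = pv x∈
    case (inj₂ x∈) = q⇒p (hQ x∈)

  -- The list `vs` holds the vertex in the gap before `B`, and `is` those in the gaps after it. The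
  -- lane `Lʸ` begins among the common out-neighbours of `vs`, ready to have `vs` put in front.
  record Woven (B : Block) (bs : List Block) (vs is : List A) : Set where
    field
      {Lʸ Lˣ Lᶻ} : List A
      laneʸ : Lane (λ x → x ∈ B × All (λ v → E v x) vs) Lʸ
      laneˣ : Lane (_∈ B) Lˣ
      laneᶻ : Lane (_∈ B) Lᶻ
      all↭  : Lʸ ++ Lˣ ++ Lᶻ ↭ concat (B ∷ bs) ++ is

  c2≤ : ∀ {l} → c4 ≤ l → c2 ≤ l
  c2≤ = ≤-trans (m≤m+n c2 c2)

  open import Algebra.Solver.CommutativeMonoid (++-commutativeMonoid {A = A}) using (solve; _⊕_; _⊜_)

  slot? : (s : A → ℕ) (p : ℕ) → Decidable (λ v → s v ≡ p)
  slot? s p v = s v ≟ p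

  module Split (is : List A) (s : A → ℕ) (≤1 : ∀ p → count (slot? s p) is ≤ 1) where

    now later : List A
    now   = filter (slot? s 0) is
    later = filter (∁? (slot? s 0)) is

    is↭ : is ↭ now ++ later
    is↭ = filter-↭-∁ (slot? s 0) is

    now≤1 : length now ≤ 1
    now≤1 = ≤1 0

    suc-pred-later : ∀ {v} → v ∈ later → suc (pred (s v)) ≡ s v
    suc-pred-later v∈ = suc-pred _ {{≢-nonZero (proj₂ (∈-filter⁻ (∁? (slot? s 0)) {xs = is} v∈))}}

    later≤1 : ∀ p → count (slot? (pred ∘ s) p) later ≤ 1
    later≤1 p = begin
      count (slot? (pred ∘ s) p) later   ≤⟨ count-⊆ (slot? (pred ∘ s) p) (slot? s (suc p)) later
                                              (λ v∈ eq → ≡.trans (sym (suc-pred-later v∈)) (cong suc eq)) ⟩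
      count (slot? s (suc p)) later      ≤⟨ count-filter (slot? s (suc p)) (∁? (slot? s 0)) is ⟩
      count (slot? s (suc p)) is         ≤⟨ ≤1 (suc p) ⟩
      1                                  ∎
      where open ≤-Reasoning

    module _ {F : A → ℕ → Set} (fits : ∀ {v} → v ∈ is → F v (s v)) where

      fits-now : ∀ {v} → v ∈ now → F v 0
      fits-now v∈ = let v∈is , s≡0 = ∈-filter⁻ (slot? s 0) v∈ in subst (F _) s≡0 (fits v∈is)

      fits-later : ∀ {v} → v ∈ later → F v (suc (pred (s v)))
      fits-later v∈ =
        subst (F _) (sym (suc-pred-later v∈)) (fits (proj₁ (∈-filter⁻ (∁? (slot? s 0)) {xs = is} v∈)))

  -- Three lanes suffice because in each block the lane Y receiving a vertex from the gap before it, the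
  -- lane X carrying one into the gap after it, and a remainder Z can be kept disjoint; at the next block
  -- X continues as Y, Y as X, and Z as Z.
  weave : ∀ B bs vs is (s : A → ℕ) → IsChain E (B ∷ bs) → c2 ≤ count (All? E? vs) B →
          (∀ {v} → v ∈ is → Fits B bs v (s v)) → (∀ p → count (slot? s p) is ≤ 1) → Woven B bs vs is
  weave B [] vs is s (tr , big , _ , _) outs fits ≤1 = record
    { laneʸ = record { head = Y ; tail = [] ; L≡ = sym (++-identityʳ≡ Y) ; long = |Y|
                     ; headP = λ x∈ → ∈Y x∈ , All.lookup allY x∈ ; power = transitive-Power trY }
    -- A vertex in the last gap ends this lane, since `X` consists of its in-neighbours.
    ; laneˣ = record { head = X ; tail = is ; L≡ = refl ; long = |X| ; headP = ∈X
                     ; power = transitive-Power (AllPairs.++⁺ trX (≤1⇒AllPairs is is≤1) allX) }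
    ; laneᶻ = record { head = Z ; tail = [] ; L≡ = sym (++-identityʳ≡ Z) ; long = |Z| ; headP = ∈Z
                     ; power = transitive-Power trZ }
    ; all↭ = ↭-trans (solve 4 (λ y x z i → y ⊕ ((x ⊕ i) ⊕ z) ⊜ (y ⊕ (x ⊕ z)) ⊕ i) ↭-refl Y X Z is)
               (++⁺ʳ is (↭-trans (↭-sym B↭) (↭-sym (++-identityʳ B)))) }
    where
    is≤1 : length is ≤ 1
    is≤1 = ≤-trans (≤-reflexive (sym (count-all (slot? s 0) {is} (λ v∈ → proj₁ (fits v∈))))) (≤1 0)
    open Division (divide (All? E? vs) (All? E˘? is) B tr big outs
                     (common E˘? c2 is B is≤1 (c2≤ big) (λ v∈ → proj₂ (fits v∈))))
  weave B (C ∷ bs) vs is s (tr , big , B⇒C , ch@(_ , bigC , _)) outs fits ≤1 = record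
    { laneʸ = extend trY |Y| (λ x∈ → ∈Y x∈ , All.lookup allY x∈) W.laneˣ (λ x∈ y∈ → B⇒C (∈Y x∈) y∈)
    ; laneˣ = extend trX |X| ∈X
                -- The new head mixes the gap vertex with vertices of `C`. Being dominated by all of
                -- `X` is the property they share, and it is what `extend` needs.
                (prepend {P = λ y → ∀ {x} → x ∈ X → E x y} now≤1 W.laneʸ (λ v∈ (_ , es) → All.lookup es v∈)
                  (λ v∈ x∈ → All.lookup (All.lookup allX x∈) v∈) (λ (y∈ , _) x∈ → B⇒C (∈X x∈) y∈))
                (λ x∈ e → e x∈)
    ; laneᶻ = extend trZ |Z| ∈Z W.laneᶻ (λ x∈ y∈ → B⇒C (∈Z x∈) y∈)
    ; all↭ = begin
        (Y ++ W.Lˣ) ++ (X ++ now ++ W.Lʸ) ++ Z ++ W.Lᶻ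
          ↭⟨ solve 7 (λ y x z n ly lx lz → (y ⊕ lx) ⊕ ((x ⊕ (n ⊕ ly)) ⊕ (z ⊕ lz)) ⊜
                        ((y ⊕ (x ⊕ z)) ⊕ (ly ⊕ (lx ⊕ lz))) ⊕ n) ↭-refl Y X Z now W.Lʸ W.Lˣ W.Lᶻ ⟩
        ((Y ++ X ++ Z) ++ (W.Lʸ ++ W.Lˣ ++ W.Lᶻ)) ++ now
          ↭⟨ ++⁺ʳ now (++⁺ (↭-sym B↭) W.all↭) ⟩
        (B ++ concat (C ∷ bs) ++ later) ++ now
          ↭⟨ solve 4 (λ b c l n → (b ⊕ (c ⊕ l)) ⊕ n ⊜ (b ⊕ c) ⊕ (n ⊕ l)) ↭-refl B (concat (C ∷ bs)) later now ⟩
        (B ++ concat (C ∷ bs)) ++ now ++ later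
          ↭⟨ ++⁺ˡ (B ++ concat (C ∷ bs)) (↭-sym is↭) ⟩
        (B ++ concat (C ∷ bs)) ++ is ∎ }
    where
    open PermutationReasoning
    open Split is s ≤1
    open Division (divide (All? E? vs) (All? E˘? now) B tr big outs
                     (common E˘? c2 now B now≤1 (c2≤ big) (λ v∈ → proj₁ (fits-now {Fits B (C ∷ bs)} fits v∈))))
    module W = Woven (weave C bs now later (pred ∘ s) ch
                        (common E? c2 now C now≤1 (c2≤ bigC) (λ v∈ → proj₂ (fits-now {Fits B (C ∷ bs)} fits v∈)))
                        (fits-later {Fits B (C ∷ bs)} fits) later≤1)

  record Cover (m : ℕ) (us : List A) : Set where
    field
      paths  : List (List A)
      powers : All Power paths
      few    : length paths ≤ m
      us↭    : us ↭ concat paths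

  cover-chain : ∀ bs is (s : A → ℕ) → IsChain E bs → (∀ {v} → v ∈ is → FitsFront bs v (s v)) →
                (∀ p → count (slot? s p) is ≤ 1) → Cover 3 (concat bs ++ is)
  cover-chain [] is s _ fits ≤1 = record
    { paths = [ is ] ; powers = transitive-Power (≤1⇒AllPairs is is≤1) ∷ [] ; few = s≤s z≤n
    ; us↭ = ↭-sym (++-identityʳ is) }
    where
    is≤1 : length is ≤ 1
    is≤1 = ≤-trans (≤-reflexive (sym (count-all (slot? s 0) {is} fits))) (≤1 0)
  cover-chain (B ∷ bs) is s ch@(_ , big , _) fits ≤1 = record
    { paths = (now ++ W.Lʸ) ∷ W.Lˣ ∷ W.Lᶻ ∷ []
    ; powers = Lane.power front ∷ Lane.power W.laneˣ ∷ Lane.power W.laneᶻ ∷ []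
    ; few = ≤-refl
    ; us↭ = begin
        concat (B ∷ bs) ++ is                ↭⟨ ++⁺ˡ (concat (B ∷ bs)) is↭ ⟩
        concat (B ∷ bs) ++ now ++ later      ↭⟨ shifts (concat (B ∷ bs)) now ⟩
        now ++ concat (B ∷ bs) ++ later      ↭⟨ ++⁺ˡ now (↭-sym W.all↭) ⟩
        now ++ W.Lʸ ++ W.Lˣ ++ W.Lᶻ          ↭⟨ ++-assoc now W.Lʸ (W.Lˣ ++ W.Lᶻ) ⟨
        (now ++ W.Lʸ) ++ W.Lˣ ++ W.Lᶻ        ↭⟨ ++⁺ˡ (now ++ W.Lʸ) (++⁺ˡ W.Lˣ (↭-sym (++-identityʳ W.Lᶻ))) ⟩
        (now ++ W.Lʸ) ++ W.Lˣ ++ W.Lᶻ ++ []  ∎ }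
    where
    open PermutationReasoning
    open Split is s ≤1
    module W = Woven (weave B bs now later (pred ∘ s) ch
                        (common E? c2 now B now≤1 (c2≤ big) (fits-now {FitsFront (B ∷ bs)} fits))
                        (fits-later {FitsFront (B ∷ bs)} fits) later≤1)
    -- A vertex in the gap before the first block starts the lane that begins in its
    -- out-neighbourhood.
    front : Lane (λ _ → ⊤) (now ++ W.Lʸ)
    front = prepend now≤1 W.laneʸ (λ v∈ (_ , es) → All.lookup es v∈) (λ _ → tt) (λ _ → tt)

  -- Peeling off maximal chains and combining their covers

  chained : ℕ → (ℕ → List Block) → List A
  chained zero    f = []
  chained (suc m) f = concat (f 0) ++ chained m (f ∘ suc)

  record Peeling (m : ℕ) (us : List A) : Set where
    field
      chains  : ℕ → List Block
      outside : List A
      us↭     : us ↭ chained m chains ++ outside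
      chain   : ∀ {i} → i < m → IsChain E (chains i)
      load    : ∀ {i} → i < m → ∀ p → count (slot-is? (chains i) p) outside ≤ ρ
      avoid   : ∀ {i} → i < m → ∀ {v} → v ∈ outside → v ∉ concat (chains i)

  -- Each chain is maximal among the vertices left by the earlier ones. Its loads can only decrease
  -- when later chains are removed, so the bound `ρ` persists for the final remainder.
  peel : ∀ m us → Unique us → Peeling m us
  peel zero us u = record
    { chains = λ _ → [] ; outside = us ; us↭ = ↭-refl ; chain = λ () ; load = λ () ; avoid = λ () }
  peel (suc m) us u = record
    { chains = chains ; outside = P.outside
    ; us↭ = ↭-trans M.us↭ (↭-trans (++⁺ˡ (concat M.blocks) P.us↭) (↭-sym (++-assoc (concat M.blocks) _ _)))
    ; chain = λ { {zero} _ → M.chain ; {suc i} (s≤s i<m) → P.chain i<m }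
    ; load = λ { {zero} _ p → ≤-trans (count-++ʳ (slot-is? M.blocks p) (chained m P.chains) P.outside)
                   (≤-trans (≤-reflexive (sym (count-↭ (slot-is? M.blocks p) P.us↭))) (M.load p))
               ; {suc i} (s≤s i<m) → P.load i<m }
    ; avoid = λ { {zero} _ v∈ v∈M →
                    proj₂ (proj₂ u′) v∈M (∈-resp-↭ (↭-sym P.us↭) (∈-++⁺ʳ (chained m P.chains) v∈)) refl
                ; {suc i} (s≤s i<m) → P.avoid i<m } }
    where
    module M = Maximal (maximal us u)
    u′ = AllPairs-++⁻ (concat M.blocks) (Unique-↭ M.us↭ u)
    module P = Peeling (peel m M.outside (proj₁ (proj₂ u′)))
    chains : ℕ → List Block
    chains zero    = M.blocks
    chains (suc i) = P.chains i

  -- Vertices assigned to chain 0 are covered together with it, and the others are passed on with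
  -- row numbers shifted. Injectivity of the assignment puts at most one vertex into each gap, as
  -- `cover-chain` requires.
  assemble : ∀ m (f : ℕ → List Block) (s : ℕ → A → ℕ) (a : A → ℕ) vs → Unique vs →
             (∀ {i} → i < m → IsChain E (f i)) →
             (∀ {i} → i < m → ∀ {v} → v ∈ vs → FitsFront (f i) v (s i v)) →
             (∀ {v} → v ∈ vs → a v < m) →
             (∀ {x y} → x ∈ vs → y ∈ vs → (a x , s (a x) x) ≡ (a y , s (a y) y) → x ≡ y) →
             Cover (m * 3) (chained m f ++ vs)
  assemble zero f s a [] u ch fits a< inj = record { paths = [] ; powers = [] ; few = z≤n ; us↭ = ↭-refl }
  assemble zero f s a (v ∷ vs) u ch fits a< inj with () ← a< (here refl)
  assemble (suc m) f s a vs u ch fits a< inj = record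
    { paths = C₀.paths ++ C₁.paths
    ; powers = All.++⁺ C₀.powers C₁.powers
    ; few = ≤-trans (≤-reflexive (length-++ C₀.paths)) (+-mono-≤ C₀.few C₁.few)
    ; us↭ = begin
        (concat (f 0) ++ chained m (f ∘ suc)) ++ vs
          ↭⟨ ++⁺ˡ (concat (f 0) ++ chained m (f ∘ suc)) (filter-↭-∁ (slot? a 0) vs) ⟩
        (concat (f 0) ++ chained m (f ∘ suc)) ++ now ++ later
          ↭⟨ solve 4 (λ b c n l → (b ⊕ c) ⊕ (n ⊕ l) ⊜ (b ⊕ n) ⊕ (c ⊕ l)) ↭-refl
               (concat (f 0)) (chained m (f ∘ suc)) now later ⟩
        (concat (f 0) ++ now) ++ chained m (f ∘ suc) ++ later    ↭⟨ ++⁺ C₀.us↭ C₁.us↭ ⟩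
        concat C₀.paths ++ concat C₁.paths                       ≡⟨ concat-++ C₀.paths C₁.paths ⟩
        concat (C₀.paths ++ C₁.paths)                            ∎ }
    where
    open PermutationReasoning
    now later : List A
    now   = filter (slot? a 0) vs
    later = filter (∁? (slot? a 0)) vs
    ∈now : ∀ {v} → v ∈ now → v ∈ vs × a v ≡ 0
    ∈now = ∈-filter⁻ (slot? a 0)
    ∈later : ∀ {v} → v ∈ later → v ∈ vs × a v ≢ 0
    ∈later = ∈-filter⁻ (∁? (slot? a 0))
    suc-pred′ : ∀ {v} → v ∈ later → suc (pred (a v)) ≡ a v
    suc-pred′ v∈ = suc-pred _ {{≢-nonZero (proj₂ (∈later v∈))}}
    same : ∀ {p x y} → x ∈ now → y ∈ now → s 0 x ≡ p → s 0 y ≡ p → x ≡ y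
    same {p} {x} {y} x∈ y∈ sx sy = inj (proj₁ (∈now x∈)) (proj₁ (∈now y∈))
      (≡.trans (at-0 x∈ sx) (sym (at-0 y∈ sy)))
      where
      at-0 : ∀ {z} → z ∈ now → s 0 z ≡ p → (a z , s (a z) z) ≡ (0 , p)
      at-0 {z} z∈ eq = ≡.trans (cong (λ i → i , s i z) (proj₂ (∈now z∈))) (cong (0 ,_) eq)
    inj′ : ∀ {x y} → x ∈ later → y ∈ later →
           (pred (a x) , s (suc (pred (a x))) x) ≡ (pred (a y) , s (suc (pred (a y))) y) → x ≡ y
    inj′ {x} {y} x∈ y∈ eq = inj (proj₁ (∈later x∈)) (proj₁ (∈later y∈))
      (≡.trans (sym (cong (λ i → i , s i x) (suc-pred′ x∈)))
        (≡.trans (cong (λ (i , p) → suc i , p) eq) (cong (λ i → i , s i y) (suc-pred′ y∈))))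
    module C₀ = Cover (cover-chain (f 0) now (s 0) (ch (s≤s z≤n)) (λ v∈ → fits (s≤s z≤n) (proj₁ (∈now v∈)))
                         (λ p → count≤1 (slot? (s 0) p) now (AllPairs.filter⁺ (slot? a 0) u) same))
    module C₁ = Cover (assemble m (f ∘ suc) (s ∘ suc) (pred ∘ a) later (AllPairs.filter⁺ (∁? (slot? a 0)) u)
                         (ch ∘ s≤s) (λ i<m v∈ → fits (s≤s i<m) (proj₁ (∈later v∈)))
                         (λ v∈ → s≤s⁻¹ (subst (_< suc m) (sym (suc-pred′ v∈)) (a< (proj₁ (∈later v∈)))))
                         inj′)

  cover : ∀ us → Unique us → Cover (ρ * 3) us
  cover us u = record { Cover C hiding (us↭) ; us↭ = ↭-trans P.us↭ (Cover.us↭ C) }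
    where
    module P = Peeling (peel ρ us u)
    s : ℕ → A → ℕ
    s i v = slot v (P.chains i)
    uo : Unique P.outside
    uo = proj₁ (proj₂ (AllPairs-++⁻ (chained ρ P.chains) (Unique-↭ P.us↭ u)))
    -- Taking as many chains as the load bound `ρ` makes degrees balance: every vertex has `ρ` slots
    -- and every slot at most `ρ` vertices.
    open Hall _≟A_ s ρ ρ ≤-refl 0<ρ
    match = matching P.outside uo P.load
    C = assemble ρ P.chains s (proj₁ match) P.outside uo P.chain
          (λ i<ρ v∈ → slot-fits-front _ (P.chains _) (P.chain i<ρ) (P.avoid i<ρ v∈))
          (proj₁ (proj₂ match)) (proj₂ (proj₂ match))

-- Application to tournaments and the numerical bound

module _ {n : ℕ} (T : Tournament n) where

  -- For distinct vertices `total` produces one of the two orientations, and `asym` excludes the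
  -- other.
  edge? : ∀ x y → Dec (_⇒_ T x y)
  edge? x y with x Fin.≟ y
  ... | yes refl = no (irrefl T x)
  ... | no x≢y with total T x y x≢y
  ... | inj₁ x⇒y = yes x⇒y
  ... | inj₂ y⇒x = no λ x⇒y → asym T x y x⇒y y⇒x

  module _ (k : ℕ) (0<k : 0 < k) where
    open Chains (_⇒_ T) edge? (λ {x} {y} → total T x y) k 0<k using (ρ; c8)
    open Lanes Fin._≟_ (_⇒_ T) edge? (λ {x} {y} → total T x y) k 0<k

    All-take-lookup : {P : Fin n → Set} (m : ℕ) (xs : List (Fin n)) → All P (take m xs) →
                      ∀ j → toℕ j < m → P (lookup xs j)
    All-take-lookup (suc m) (x ∷ xs) (p ∷ _)  zero    _         = p
    All-take-lookup (suc m) (x ∷ xs) (_ ∷ ps) (suc j) (s≤s j<m) = All-take-lookup m xs ps j j<m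

    Power-lookup : ∀ xs → Power xs → ∀ i j → toℕ i < toℕ j → toℕ j ≤ toℕ i + k →
                   _⇒_ T (lookup xs i) (lookup xs j)
    Power-lookup (x ∷ xs) (p , _)  zero    (suc j) _         j≤k       = All-take-lookup k xs p j j≤k
    Power-lookup (x ∷ xs) (_ , pw) (suc i) (suc j) (s≤s i<j) (s≤s j≤) = Power-lookup xs pw i j i<j j≤

    -- Path powers must have a vertex, but an empty chain with nothing in its gap is covered by an
    -- empty list; such lists are discarded.
    nonempty : ∀ {m us} → Cover m us → Σ (Cover m us) λ C → All (_≢ []) (Cover.paths C)
    nonempty {m} {us} record { paths = paths ; powers = powers ; few = few ; us↭ = us↭ } = go paths powers few us↭
      where
      go : ∀ {m us} ps → All Power ps → length ps ≤ m → us ↭ concat ps →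
           Σ (Cover m us) λ C → All (_≢ []) (Cover.paths C)
      go [] _ h p = record { paths = [] ; powers = [] ; few = h ; us↭ = p } , []
      go ([] ∷ ps) (_ ∷ pws) h p = go ps pws (≤-trans (n≤1+n _) h) p
      go {suc m} {us} ((x ∷ xs) ∷ ps) (pw ∷ pws) (s≤s h) p with go {us = concat ps} ps pws h ↭-refl
      ... | C , ne = record
        { paths = (x ∷ xs) ∷ Cover.paths C ; powers = pw ∷ Cover.powers C ; few = s≤s (Cover.few C)
        ; us↭ = ↭-trans p (++⁺ˡ (x ∷ xs) (Cover.us↭ C)) } , (λ ()) ∷ ne

    path-powers : ∀ ps → Unique (concat ps) → All Power ps → All (_≢ []) ps → All (IsPathPower T k) ps
    path-powers [] _ _ _ = []
    path-powers (xs ∷ ps) u (pw ∷ pws) (ne ∷ nes) =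
      (proj₁ u′ , ne , Power-lookup xs pw) ∷ path-powers ps (proj₁ (proj₂ u′)) pws nes
      where u′ = AllPairs-++⁻ xs u

    -- Here `ρ` is 2 to the power `40 * k`. The factor 3 is at most `2 ^ 2`, and `2 ≤ k + k`, so an
    -- exponent of `42 * k` is enough.
    3ρ≤ : ρ * 3 ≤ 2 ^ (100000 * k)
    3ρ≤ = begin
      ρ * 3                              ≤⟨ *-monoʳ-≤ ρ (n≤1+n 3) ⟩
      ρ * 2 ^ 2                          ≡⟨ cong (_* 2 ^ 2) ρ≡ ⟩
      2 ^ e * 2 ^ 2                      ≡⟨ ^-distribˡ-+-* 2 e 2 ⟨
      2 ^ (e + 2)                        ≤⟨ ^-monoʳ-≤ 2 exponent ⟩
      2 ^ (100000 * k)                   ∎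
      where
      open ≤-Reasoning
      e = c8 + (c8 + c8) + c8 + c8
      ρ≡ : ρ ≡ 2 ^ e
      ρ≡ = ≡.trans (cong (_* 2 ^ c8) (sym (^-distribˡ-+-* 2 (c8 + (c8 + c8)) c8)))
                   (sym (^-distribˡ-+-* 2 (c8 + (c8 + c8) + c8) c8))
      forty : ∀ k → let c2 = k + k; c4 = c2 + c2; c8 = c4 + c4 in c8 + (c8 + c8) + c8 + c8 + (k + k) ≡ 42 * k
      forty = solve-∀
      exponent : e + 2 ≤ 100000 * k
      exponent = begin
        e + 2              ≤⟨ +-monoʳ-≤ e (+-mono-≤ 0<k 0<k) ⟩
        e + (k + k)        ≡⟨ forty k ⟩
        42 * k             ≤⟨ *-monoˡ-≤ k {42} {100000} (m≤m+n 42 99958) ⟩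
        100000 * k         ∎

    partition : Σ (List (List (Fin n))) λ P → IsPathPowerPartition T k P × length P ≤ ρ * 3
    partition with nonempty (cover (allFin n) (allFin⁺ n))
    ... | C , ne = Cover.paths C ,
      (path-powers _ u (Cover.powers C) ne , u , λ v → ∈-resp-↭ (Cover.us↭ C) (∈-allFin v)) , Cover.few C
      where u = Unique-↭ (Cover.us↭ C) (allFin⁺ n)

theorem1p2 : (k : ℕ) → .{{_ : NonZero k}} → (n : ℕ) → (T : Tournament n) →
    Σ (List (List (Fin n))) (λ P →
    IsPathPowerPartition T k P × length P ≤ 2 ^ (100000 * k))
theorem1p2 k n T = proj₁ P , proj₁ (proj₂ P) , ≤-trans (proj₂ (proj₂ P)) (3ρ≤ T k (>-nonZero⁻¹ k))
  where P = partition T k (>-nonZero⁻¹ k)
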